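{- Let $k\geq 2$ be an integer, and let $G$ be a graph. If $$\delta(G)\geq\frac{2\alpha(G)}{2k+1},$$ then $G$ has a $\{K_{1,1},K_{1,2},\ldots,K_{1,k},\mathcal{T}(2k+1)\}$-factor.
   Context: All graphs are finite, undirected, without loops or multiple edges; $\delta(G)$ is the minimum degree and $\alpha(G)$ the independence number of $G$. $K_{1,j}$ denotes the star with $j$ leaves. For a set $\mathcal{H}$ of connected graphs, an $\mathcal{H}$-factor of $G$ is a spanning subgraph of $G$ each of whose connected components is isomorphic to an element of $\mathcal{H}$. The family $\mathcal{T}(2k+1)$ ($k\geq2$) is defined as follows. For a tree $T$, $Leaf(T)$ is its set of leaves. Let $R$ be a tree such that for every $x\in V(R)\setminus Leaf(R)$: (a) $d_{R-Leaf(R)}(x)\in\{1,3,\ldots,2k+1\}$, and (b) $2\cdot(\text{number of leaves of } R \text{ adjacent to } x)+d_{R-Leaf(R)}(x)\leq 2k+1$. From such $R$ build a tree $T_R$ by (c) inserting a new vertex of degree 2 into each edge of $R-Leaf(R)$, and (d) for every vertex $x$ of $R-Leaf(R)$ with $d_{R-Leaf(R)}(x)=2r+1<2k+1$, attaching $k-r-(\text{number of leaves of } R \text{ adjacent to } x)$ new pendant edges to $x$. Then $\mathcal{T}(2k+1)$ is the set of all trees $T_R$ over all trees $R$ satisfying (a) and (b). A $\{K_{1,1},\ldots,K_{1,k},\mathcal{T}(2k+1)\}$-factor is an $\mathcal{H}$-factor with $\mathcal{H}=\{K_{1,1},\ldots,K_{1,k}\}\cup\mathcal{T}(2k+1)$.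 -}

module Defs where

open import Data.Bool using (Bool; true; false; if_then_else_; not; _∨_; T)
open import Data.Nat using (ℕ; zero; suc; _+_; _*_; _∸_; _≤_; _<ᵇ_; _≡ᵇ_; ⌊_/2⌋)
open import Data.Fin using (Fin; toℕ) renaming (zero to fzero; suc to fsuc)
open import Data.Fin.Subset using (Subset; _∈_; ∣_∣)
open import Data.List using (List; []; _∷_; _++_; map; length; allFin)
open import Data.Nat.ListAction using (sum)
open import Data.List.Relation.Unary.Linked using (Linked)
open import Data.List.Relation.Unary.Unique.Propositional using (Unique)
open import Data.Product using (Σ; _×_; _,_)
open import Relation.Binary.PropositionalEquality using (_≡_)
open import Relation.Nullary using (¬_)

record Graph : Set where
  field
    n      : ℕ
    adj    : Fin n → Fin n → Bool
    sym    : ∀ u v → adj u v ≡ adj v u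
    irrefl : ∀ v → adj v v ≡ false
open Graph public

countB : ∀ {n} → (Fin n → Bool) → List (Fin n) → ℕ
countB p xs = sum (map (λ u → if p u then 1 else 0) xs)

deg : (G : Graph) → Fin (n G) → ℕ
deg G v = countB (adj G v) (allFin (n G))

IsMinDegree : (G : Graph) → ℕ → Set
IsMinDegree G d = Σ (Fin (n G)) (λ v → deg G v ≡ d) × (∀ v → d ≤ deg G v)

Independent : (G : Graph) → Subset (n G) → Set
Independent G S = ∀ u v → u ∈ S → v ∈ S → adj G u v ≡ false

IsIndependenceNumber : (G : Graph) → ℕ → Set
IsIndependenceNumber G a =
  Σ (Subset (n G)) (λ S → Independent G S × ∣ S ∣ ≡ a)
  × (∀ S → Independent G S → ∣ S ∣ ≤ a)

data Walk (G : Graph) : Fin (n G) → Fin (n G) → Set where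
  []  : ∀ {u} → Walk G u u
  _∷_ : ∀ {u v w} → adj G u v ≡ true → Walk G v w → Walk G u w

HasCycle : Graph → Set
HasCycle G = Σ (Fin (n G)) λ x → Σ (List (Fin (n G))) λ xs →
  2 ≤ length xs × Unique (x ∷ xs)
  × Linked (λ u v → adj G u v ≡ true) (x ∷ xs ++ (x ∷ []))

IsTree : Graph → Set
IsTree G = 1 ≤ n G × (∀ u v → Walk G u v) × ¬ HasCycle G

module _ (R : Graph) where
  isLeaf : Fin (n R) → Bool
  isLeaf x = deg R x ≡ᵇ 1

  internal : Fin (n R) → Bool
  internal x = not (isLeaf x)

  dI : Fin (n R) → ℕ
  dI x = countB (λ u → adj R x u Data.Bool.∧ internal u) (allFin (n R))

  nLeaves : Fin (n R) → ℕ
  nLeaves x = countB (λ u → adj R x u Data.Bool.∧ isLeaf u) (allFin (n R))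

Admissible : ℕ → Graph → Set
Admissible k R = ∀ x → isLeaf R x ≡ false →
  Σ ℕ (λ t → t ≤ k × dI R x ≡ 2 * t + 1)
  × 2 * nLeaves R x + dI R x ≤ 2 * k + 1

-- number of new pendant edges attached to x in step (d):
-- if d_{R-Leaf(R)}(x) = 2r+1 < 2k+1 then k - r - (#leaves adjacent), else 0
extra : ℕ → (R : Graph) → Fin (n R) → ℕ
extra k R x = if dI R x <ᵇ (2 * k + 1)
              then k ∸ ⌊ dI R x ∸ 1 /2⌋ ∸ nLeaves R x
              else 0

data TRV (k : ℕ) (R : Graph) : Set where
  orig : Fin (n R) → TRV k R
  -- subdivision vertex of the edge xy of R - Leaf(R)  (x < y)
  sub  : (x y : Fin (n R)) → T (toℕ x <ᵇ toℕ y) → T (adj R x y)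
       → T (internal R x) → T (internal R y) → TRV k R
  new  : (x : Fin (n R)) → T (internal R x) → (i : ℕ) → T (i <ᵇ extra k R x)
       → TRV k R

data TRE (k : ℕ) (R : Graph) : TRV k R → TRV k R → Set where
  oo  : ∀ x y → adj R x y ≡ true → (isLeaf R x ∨ isLeaf R y) ≡ true
      → TRE k R (orig x) (orig y)
  os₁ : ∀ x y p a ix iy → TRE k R (orig x) (sub x y p a ix iy)
  os₂ : ∀ x y p a ix iy → TRE k R (orig y) (sub x y p a ix iy)
  on  : ∀ x ix i p → TRE k R (orig x) (new x ix i p)

data Shape (k : ℕ) : Set where
  star : (j : ℕ) → 1 ≤ j → j ≤ k → Shape k
  tree : (R : Graph) → IsTree R → Admissible k R → Shape k

SV : ∀ {k} → Shape k → Set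
SV (star j _ _)   = Fin (suc j)
SV {k} (tree R _ _) = TRV k R

data StarE (j : ℕ) : Fin (suc j) → Fin (suc j) → Set where
  ray : ∀ i → StarE j fzero (fsuc i)

SE : ∀ {k} (s : Shape k) → SV s → SV s → Set
SE (star j _ _)     = StarE j
SE {k} (tree R _ _) = TRE k R

-- An H-factor: vertex-disjoint subgraphs of G, each a copy of a member of H,
-- covering V(G).  Its components are the images of the embeddings.
record Factor (k : ℕ) (G : Graph) : Set where
  field
    m        : ℕ
    shape    : Fin m → Shape k
    emb      : (i : Fin m) → SV (shape i) → Fin (n G)
    edges    : ∀ i a b → SE (shape i) a b → adj G (emb i a) (emb i b) ≡ true
    cover    : ∀ v → Σ (Fin m) λ i → Σ (SV (shape i)) λ a → emb i a ≡ v
    disjoint : ∀ i a j b → emb i a ≡ emb j b →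
               _≡_ {A = Σ (Fin m) λ i → SV (shape i)} (i , a) (j , b)

-- Let I be an independent set maximising |I| − |N(I)|, let A = N(I) and let R be the remaining vertices.
--
-- Every vertex of I ("client") sends two tokens to neighbours in A ("servers").  In an assignment minimising the sum of
-- the squared loads every server gets at least 1 and at most 2k + 1 tokens: an idle server would contradict the choice of
-- I, and an overloaded one the inequality 2|X| ≤ (2k + 1)|N(X)|, which the degree condition gives for independent X.
--
-- Among the assignments within these bounds take one with the fewest split clients, that is, clients whose tokens go to
-- different servers.  Let H be the graph on A with one edge for each split client, joining its two servers.  H is a forest,
-- since rotating the tokens around a cycle would make its clients solid.  The ends of an edge of H both have load 2k + 1
-- or both have load 1, since otherwise a token could be shifted along the edge.  In a component of H of load 2k + 1 every
-- vertex with s solid clients has the odd degree 2k + 1 − 2s; with the solid clients attached as leaves it is a tree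
-- satisfying (a) and (b), and the split clients are the subdivision vertices of T_R.  An edge of H with ends of load 1 is
-- a K_{1,2} centred at its client.  A server with solid clients only is the centre of a star with at most k leaves.
--
-- On R the same balancing, with one token per vertex, yields an injection R → R along edges, because the choice of I makes
-- |N(X) ∩ R| ≥ |X| for X ⊆ R.  An inclusion-minimal set of its arcs covering R consists of disjoint copies of K_{1,1} and
-- K_{1,2}.

module Submission where

open import Defs hiding (n; sym)
open import Data.Bool using (Bool; true; false; if_then_else_; not; _∨_; _∧_; T)
import Data.Bool.Properties as Bool
open import Data.Empty using (⊥; ⊥-elim)
open import Data.Fin using (Fin; zero; suc; toℕ)
import Data.Fin.Properties as Fin
open import Data.Fin.Subset using (_∈_; ∣_∣)
open import Data.List using (List; []; _∷_; _++_; length; allFin)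
import Data.List as List
import Data.List.Properties as List
open import Data.List.Relation.Unary.All using (All; []; _∷_)
import Data.List.Relation.Unary.All as All
import Data.List.Relation.Unary.All.Properties as All
open import Data.List.Relation.Unary.AllPairs using ([]; _∷_)
open import Data.List.Relation.Unary.Linked using (Linked; []; [-]; _∷_)
import Data.List.Relation.Unary.Linked as Linked
import Data.List.Relation.Unary.Linked.Properties as Linked
open import Data.List.Relation.Unary.Unique.Propositional using (Unique)
import Data.List.Relation.Unary.Unique.Propositional.Properties as Unique
open import Data.Nat using (ℕ; zero; suc; _+_; _*_; _∸_; _≤_; _<_; z≤n; s≤s; s≤s⁻¹; _<ᵇ_; _≡ᵇ_; ⌊_/2⌋)
open import Data.Nat.Induction using (<-wellFounded)
import Data.Nat.Properties as ℕ
open import Data.Nat.Tactic.RingSolver using (solve-∀)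
open import Data.Product using (Σ; ∃; _×_; _,_; proj₁; proj₂)
open import Data.Sum using (_⊎_; inj₁; inj₂; [_,_]′)
open import Data.Unit using (⊤; tt)
open import Data.Vec using (Vec; []; _∷_; lookup; tabulate)
import Data.Vec.Properties as Vec
open import Function using (_∘_; id)
open import Function.Bundles using (module Equivalence; mk⇔)
open import Induction.WellFounded using (Acc; acc)
open import Relation.Binary.Construct.Closure.ReflexiveTransitive using (Star; ε; _◅_; _◅◅_)
open import Relation.Binary.PropositionalEquality
  using (_≡_; _≢_; refl; sym; trans; cong; cong₂; subst; subst₂; module ≡-Reasoning)
open import Relation.Nullary using (¬_; Dec; yes; no; does; _×-dec_; _⊎-dec_; ¬?; _→-dec_)
open import Relation.Nullary.Decidable using (dec-true; dec-false; does-⇔)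
open import Relation.Unary using (Decidable)
open import Algebra.Properties.CommutativeMonoid.Sum ℕ.+-0-commutativeMonoid
  using (sum; sum-cong-≗; ∑-distrib-+; ∑-comm; sum-replicate-zero)
open import Algebra.Properties.Semiring.Sum ℕ.+-*-semiring using (*-distribˡ-sum)

open ≡-Reasoning

private
  variable
    n m b : ℕ
    P Q S : Fin n → Set

-- Indicators and finite sums.

⟦_⟧ : {A : Set} → Dec A → ℕ
⟦ d ⟧ = if does d then 1 else 0

⟦⟧-yes : {A : Set} (d : Dec A) → A → ⟦ d ⟧ ≡ 1
⟦⟧-yes d a rewrite dec-true d a = refl

⟦⟧-no : {A : Set} (d : Dec A) → ¬ A → ⟦ d ⟧ ≡ 0
⟦⟧-no d ¬a rewrite dec-false d ¬a = refl

⟦⟧-mono : {A B : Set} (d : Dec A) (e : Dec B) → (A → B) → ⟦ d ⟧ ≤ ⟦ e ⟧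
⟦⟧-mono (no _)  e f = z≤n
⟦⟧-mono (yes a) e f = ℕ.≤-reflexive (sym (⟦⟧-yes e (f a)))

⟦⟧-cong : {A B : Set} (d : Dec A) (e : Dec B) → (A → B) → (B → A) → ⟦ d ⟧ ≡ ⟦ e ⟧
⟦⟧-cong d e f g = ℕ.≤-antisym (⟦⟧-mono d e f) (⟦⟧-mono e d g)

sum-mono : {f g : Fin n → ℕ} → (∀ x → f x ≤ g x) → sum f ≤ sum g
sum-mono {zero}  h = z≤n
sum-mono {suc n} h = ℕ.+-mono-≤ (h zero) (sum-mono (h ∘ suc))

sum-mono-< : {f g : Fin n → ℕ} → (∀ x → f x ≤ g x) → ∀ a → f a < g a → sum f < sum g
sum-mono-< {suc n} h zero    l = ℕ.+-mono-<-≤ l (sum-mono (h ∘ suc))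
sum-mono-< {suc n} h (suc a) l = ℕ.+-mono-≤-< (h zero) (sum-mono-< (h ∘ suc) a l)

-- Only the term at `a` differs. The equation is additive to avoid truncated subtraction; the
-- balance equations for loads below have the same form.
sum-change : {f g : Fin n → ℕ} (a : Fin n) → (∀ x → x ≢ a → f x ≡ g x) →
  sum f + g a ≡ sum g + f a
sum-change {suc n} {f} {g} zero h
  rewrite sum-cong-≗ {x = f ∘ suc} {y = g ∘ suc} (λ x → h (suc x) λ ()) = lem (f zero) (g zero) _
  where
  lem : ∀ x y s → x + s + y ≡ y + s + x
  lem = solve-∀
sum-change {suc n} {f} {g} (suc a) h
  rewrite h zero (λ ()) = begin
    g zero + sum (f ∘ suc) + g (suc a)   ≡⟨ ℕ.+-assoc (g zero) _ _ ⟩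
    g zero + (sum (f ∘ suc) + g (suc a)) ≡⟨ cong (g zero +_)
        (sum-change a (λ x x≢a → h (suc x) (x≢a ∘ Fin.suc-injective))) ⟩
    g zero + (sum (g ∘ suc) + f (suc a)) ≡⟨ ℕ.+-assoc (g zero) _ _ ⟨
    g zero + sum (g ∘ suc) + f (suc a)   ∎

sum-zero : {f : Fin n → ℕ} → (∀ x → f x ≡ 0) → sum f ≡ 0
sum-zero {n} h = trans (sum-cong-≗ h) (sum-replicate-zero n)

sum-single : {f : Fin n → ℕ} (a : Fin n) → (∀ x → x ≢ a → f x ≡ 0) → sum f ≡ f a
sum-single {n} {f} a h = begin
  sum f                     ≡⟨ ℕ.+-identityʳ _ ⟨
  sum f + 0                 ≡⟨ sum-change {g = λ _ → 0} a h ⟩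
  sum {n} (λ _ → 0) + f a   ≡⟨ cong (_+ f a) (sum-zero {n} λ _ → refl) ⟩
  f a                       ∎

term≤sum : (f : Fin n → ℕ) (a : Fin n) → f a ≤ sum f
term≤sum f zero    = ℕ.m≤m+n _ _
term≤sum f (suc a) = ℕ.≤-trans (term≤sum (f ∘ suc) a) (ℕ.m≤n+m _ _)

sum-pos : (f : Fin n → ℕ) → 0 < sum f → ∃ λ a → 0 < f a
sum-pos {suc n} f h with f zero in eq
... | suc _ = zero , subst (0 <_) (sym eq) (s≤s z≤n)
... | zero  with sum-pos (f ∘ suc) h
... | a , l = suc a , l

-- Counting

opaque

  # : {P : Fin n → Set} → Decidable P → ℕ
  # P? = sum λ x → ⟦ P? x ⟧

  #-mono : (P? : Decidable P) (Q? : Decidable Q) → (∀ x → P x → Q x) → # P? ≤ # Q?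
  #-mono P? Q? h = sum-mono λ x → ⟦⟧-mono (P? x) (Q? x) (h x)

  #-mono-< : (P? : Decidable P) (Q? : Decidable Q) → (∀ x → P x → Q x) → ∀ a → Q a → ¬ P a → # P? < # Q?
  #-mono-< P? Q? h a q ¬p = sum-mono-< (λ x → ⟦⟧-mono (P? x) (Q? x) (h x)) a
    (subst₂ _<_ (sym (⟦⟧-no (P? a) ¬p)) (sym (⟦⟧-yes (Q? a) q)) (s≤s z≤n))

  #-cong : (P? : Decidable P) (Q? : Decidable Q) → (∀ x → P x → Q x) → (∀ x → Q x → P x) → # P? ≡ # Q?
  #-cong P? Q? f g = ℕ.≤-antisym (#-mono P? Q? f) (#-mono Q? P? g)

  #-disjoint : (P? : Decidable P) (Q? : Decidable Q) (S? : Decidable S) →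
    (∀ x → P x → S x) → (∀ x → Q x → S x) → (∀ x → P x → ¬ Q x) → # P? + # Q? ≤ # S?
  #-disjoint {P = P} {Q = Q} P? Q? S? f g h = ℕ.≤-trans
      (ℕ.≤-reflexive (sym (∑-distrib-+ (λ x → ⟦ P? x ⟧) (λ x → ⟦ Q? x ⟧))))
          (sum-mono λ x → pt x (P? x) (Q? x))
    where
    pt : ∀ x (p : Dec (P x)) (q : Dec (Q x)) → ⟦ p ⟧ + ⟦ q ⟧ ≤ ⟦ S? x ⟧
    pt x (yes p) (yes q) = ⊥-elim (h x p q)
    pt x (yes p) (no _)  = ⟦⟧-mono (yes p) (S? x) (f x)
    pt x (no _)  q       = ⟦⟧-mono q (S? x) (g x)

  #-cover : (P? : Decidable P) (Q? : Decidable Q) (S? : Decidable S) →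
    (∀ x → S x → P x ⊎ Q x) → # S? ≤ # P? + # Q?
  #-cover {S = S} P? Q? S? f = ℕ.≤-trans (sum-mono λ x → pt x (S? x))
      (ℕ.≤-reflexive (∑-distrib-+ (λ x → ⟦ P? x ⟧) (λ x → ⟦ Q? x ⟧)))
    where
    pt : ∀ x (s : Dec (S x)) → ⟦ s ⟧ ≤ ⟦ P? x ⟧ + ⟦ Q? x ⟧
    pt x (no _)  = z≤n
    pt x (yes s) with f x s
    ... | inj₁ p rewrite ⟦⟧-yes (P? x) p = s≤s z≤n
    ... | inj₂ q rewrite ⟦⟧-yes (Q? x) q = ℕ.m≤n+m 1 _

  #-single : (P? : Decidable P) (a : Fin n) → P a → (∀ x → P x → x ≡ a) → # P? ≡ 1
  #-single P? a p h = trans (sum-single a λ x x≢a → ⟦⟧-no (P? x) (x≢a ∘ h x)) (⟦⟧-yes (P? a) p)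

  #-pos : (P? : Decidable P) (a : Fin n) → P a → 1 ≤ # P?
  #-pos P? a p = ℕ.≤-trans (ℕ.≤-reflexive (sym (⟦⟧-yes (P? a) p))) (term≤sum (λ x → ⟦ P? x ⟧) a)

  #-witness : (P? : Decidable P) → 0 < # P? → ∃ P
  #-witness P? h with sum-pos (λ x → ⟦ P? x ⟧) h
  ... | a , l with P? a
  ... | yes p = a , p

  #-empty : (P? : Decidable P) → (∀ x → ¬ P x) → # P? ≡ 0
  #-empty P? h = sum-zero λ x → ⟦⟧-no (P? x) (h x)

  -- With `h` a load, one overloaded server among servers of load at least `c` makes the bound on
  -- their total number of tokens strict. `weight-below` is the counterpart for one server short of
  -- `c`.
  weight-above : (P? : Decidable P) (c : ℕ) (h : Fin n → ℕ) → (∀ x → P x → c ≤ h x) →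
    ∀ a → P a → c < h a → c * # P? < sum (λ x → ⟦ P? x ⟧ * h x)
  weight-above {P = P} P? c h ge a p gt = subst (_< _) (sym (*-distribˡ-sum c λ x → ⟦ P? x ⟧))
    (sum-mono-< (λ x → le x (P? x)) a (lt (P? a)))
    where
    le : ∀ x (d : Dec (P x)) → c * ⟦ d ⟧ ≤ ⟦ d ⟧ * h x
    le x (no _)  = ℕ.≤-reflexive (ℕ.*-zeroʳ c)
    le x (yes q) = subst₂ _≤_ (sym (ℕ.*-identityʳ c)) (sym (ℕ.+-identityʳ _)) (ge x q)
    lt : (d : Dec (P a)) → c * ⟦ d ⟧ < ⟦ d ⟧ * h a
    lt (no ¬p) = ⊥-elim (¬p p)
    lt (yes _) = subst₂ _<_ (sym (ℕ.*-identityʳ c)) (sym (ℕ.+-identityʳ _)) gt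

  weight-below : (P? : Decidable P) (c : ℕ) (h : Fin n → ℕ) → (∀ x → P x → h x ≤ c) →
    ∀ a → P a → h a < c → sum (λ x → ⟦ P? x ⟧ * h x) < c * # P?
  weight-below {P = P} P? c h ge a p gt = subst (_ <_) (sym (*-distribˡ-sum c λ x → ⟦ P? x ⟧))
    (sum-mono-< (λ x → le x (P? x)) a (lt (P? a)))
    where
    le : ∀ x (d : Dec (P x)) → ⟦ d ⟧ * h x ≤ c * ⟦ d ⟧
    le x (no _)  = z≤n
    le x (yes q) = subst₂ _≤_ (sym (ℕ.+-identityʳ _)) (sym (ℕ.*-identityʳ c)) (ge x q)
    lt : (d : Dec (P a)) → ⟦ d ⟧ * h a < c * ⟦ d ⟧
    lt (no ¬p) = ⊥-elim (¬p p)
    lt (yes _) = subst₂ _<_ (sym (ℕ.+-identityʳ _)) (sym (ℕ.*-identityʳ c)) gt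

-- Exhaustive search and closures

Searchable : Set → Set₁
Searchable A = {P : A → Set} → Decidable P → Dec (∃ P)

search-Bool : Searchable Bool
search-Bool P? with P? true | P? false
... | yes p | _     = yes (true , p)
... | no _  | yes q = yes (false , q)
... | no ¬p | no ¬q = no λ { (true , p) → ¬p p ; (false , q) → ¬q q }

search-Vec : {A : Set} → Searchable A → Searchable (Vec A n)
search-Vec {zero} s P? with P? []
... | yes p = yes ([] , p)
... | no ¬p = no λ { ([] , p) → ¬p p }
search-Vec {suc n} s P? with s (λ a → search-Vec {n} s (λ v → P? (a ∷ v)))
... | yes (a , v , p) = yes (a ∷ v , p)
... | no ¬p = no λ { (a ∷ v , p) → ¬p (a , v , p) }

opaque

  minimise : {A : Set} → Searchable A → {P : A → Set} → Decidable P → (μ : A → ℕ) → ∃ P →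
    ∃ λ a → P a × (∀ a′ → P a′ → μ a ≤ μ a′)
  minimise {A} s {P} P? μ (a₀ , p₀) = go a₀ p₀ (<-wellFounded (μ a₀))
    where
    go : ∀ a → P a → Acc _<_ (μ a) → ∃ λ a → P a × (∀ a′ → P a′ → μ a ≤ μ a′)
    go a p (acc rs) with s (λ a′ → P? a′ ×-dec (μ a′ ℕ.<? μ a))
    ... | yes (a′ , p′ , l) = go a′ p′ (rs l)
    ... | no h = a , p , λ a′ p′ → ℕ.≮⇒≥ (λ l → h (a′ , p′ , l))

  iterate : {A B : Set} (μ : A → ℕ) → ((a : A) → B ⊎ ∃ λ a′ → μ a′ < μ a) → A → B
  iterate {A} {B} μ step a = go a (<-wellFounded (μ a))
    where
    go : ∀ a → Acc _<_ (μ a) → B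
    go a (acc rs) with step a
    ... | inj₁ b = b
    ... | inj₂ (a′ , l) = go a′ (rs l)

Is : (Fin n → Bool) → Fin n → Set
Is W x = W x ≡ true

is? : (W : Fin n → Bool) → Decidable (Is W)
is? W x = W x Bool.≟ true

insert : Fin n → (Fin n → Bool) → Fin n → Bool
insert a W x = does (x Fin.≟ a) ∨ W x

does⁻ : {A : Set} (d : Dec A) → does d ≡ true → A
does⁻ (yes a) _ = a

insert-new : (a : Fin n) (W : Fin n → Bool) → Is (insert a W) a
insert-new a W rewrite dec-true (a Fin.≟ a) refl = refl

insert-old : (a : Fin n) (W : Fin n → Bool) → ∀ x → Is W x → Is (insert a W) x
insert-old a W x h rewrite h = Bool.∨-zeroʳ _

insert⁻ : (a : Fin n) (W : Fin n → Bool) → ∀ x → Is (insert a W) x → x ≡ a ⊎ Is W x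
insert⁻ a W x h with x Fin.≟ a
... | yes e = inj₁ e
... | no _  = inj₂ h

opaque

  -- `Y` need not be the least closed set. Whatever is wanted of its points, such as a path or a
  -- rerouting back to `Y₀`, is put into `Inv` and carried along as points are added one at a time.
  closure : {Rel : Fin n → Fin n → Set} → (∀ x y → Dec (Rel x y)) → (Inv : (Fin n → Bool) → Set) →
    (∀ Y x y → Inv Y → Is Y x → ¬ Is Y y → Rel x y → Inv (insert y Y)) →
    ∀ Y₀ → Inv Y₀ → ∃ λ Y → Inv Y × (∀ x → Is Y₀ x → Is Y x) × (∀ x y → Is Y x → Rel x y → Is Y y)
  closure {n} {Rel} Rel? Inv step Y₀ inv₀ = iterate μ next (Y₀ , inv₀ , λ _ → id)
    where
    State Result : Set
    State = ∃ λ Y → Inv Y × (∀ x → Is Y₀ x → Is Y x)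
    Result = ∃ λ Y → Inv Y × (∀ x → Is Y₀ x → Is Y x) × (∀ x y → Is Y x → Rel x y → Is Y y)
    μ : State → ℕ
    μ (Y , _) = # (λ x → ¬? (is? Y x))
    next : (s : State) → Result ⊎ (∃ λ s′ → μ s′ < μ s)
    next (Y , inv , inc) with Fin.any? (λ x → Fin.any? (λ y → is? Y x ×-dec ¬? (is? Y y) ×-dec Rel? x y))
    ... | yes (x , y , Yx , ¬Yy , r) =
        inj₂ ((insert y Y , step Y x y inv Yx ¬Yy r , λ z → insert-old y Y z ∘ inc z) ,
          #-mono-< (λ z → ¬? (is? (insert y Y) z)) (λ z → ¬? (is? Y z)) (λ z nz → nz ∘ insert-old y Y z) y
              ¬Yy (λ nz → nz (insert-new y Y)))
    ... | no h = inj₁ (Y , inv , inc , λ x y Yx r → closed x y Yx r (is? Y y))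
      where
      closed : ∀ x y → Is Y x → Rel x y → Dec (Is Y y) → Is Y y
      closed x y Yx r (yes Yy) = Yy
      closed x y Yx r (no ¬Yy) = ⊥-elim (h (x , y , Yx , ¬Yy , r))

-- Load balancing

-- `f i v` is the server that receives the `i`-th token of `v`. There are `b` tokens per vertex: two
-- for the clients in `I`, one for the vertices of `R`.
Assignment : ℕ → ℕ → Set
Assignment b n = Fin b → Fin n → Fin n

move : Assignment b n → Fin b → Fin n → Fin n → Assignment b n
move f i v y j w = if does ((j Fin.≟ i) ×-dec (w Fin.≟ v)) then y else f j w

move-same : (f : Assignment b n) (i : Fin b) (v y : Fin n) → move f i v y i v ≡ y
move-same f i v y rewrite dec-true ((i Fin.≟ i) ×-dec (v Fin.≟ v)) (refl , refl) = refl

move-other : (f : Assignment b n) (i : Fin b) (v y : Fin n) {j : Fin b} {w : Fin n} →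
  ¬ (j ≡ i × w ≡ v) → move f i v y j w ≡ f j w
move-other f i v y {j} {w} ne rewrite dec-false ((j Fin.≟ i) ×-dec (w Fin.≟ v)) ne = refl

sum₂-change : {f g : Fin b → Fin n → ℕ} (i : Fin b) (v : Fin n) →
  (∀ j w → ¬ (j ≡ i × w ≡ v) → f j w ≡ g j w) →
  sum (sum ∘ f) + g i v ≡ sum (sum ∘ g) + f i v
sum₂-change {f = f} {g} i v h = cancel (sum (sum ∘ f)) (sum (sum ∘ g)) (sum (g i)) (sum (f i)) (f i v) (g i v)
  (sum-change i λ j j≢i → sum-cong-≗ λ w → h j w (j≢i ∘ proj₁))
  (sum-change v λ w w≢v → h i w (w≢v ∘ proj₂))
  where
  cancel : ∀ x y c d p q → x + c ≡ y + d → d + q ≡ c + p → x + q ≡ y + p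
  cancel x y c d p q e₁ e₂ =
      ℕ.+-cancelʳ-≡ (c + d) _ _ (trans (l₁ x c d q) (trans (cong₂ _+_ e₁ e₂) (l₂ y c d p)))
    where
    l₁ : ∀ x c d q → x + q + (c + d) ≡ x + c + (d + q)
    l₁ = solve-∀
    l₂ : ∀ y c d p → y + d + (c + p) ≡ y + p + (c + d)
    l₂ = solve-∀

opaque

  -- The search runs over vectors of vectors, and an assignment read back from its table is only
  -- pointwise equal to the original; hence `P` and `μ` have to respect pointwise equality.
  minAssignment : {P : Assignment b n → Set} → (∀ f → Dec (P f)) →
    (∀ f g → (∀ i v → f i v ≡ g i v) → P f → P g) →
    (μ : Assignment b n → ℕ) → (∀ f g → (∀ i v → f i v ≡ g i v) → μ f ≡ μ g) → ∃ P →
    ∃ λ f → P f × (∀ g → P g → μ f ≤ μ g)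
  minAssignment {b} {n} {P} P? P-resp μ μ-resp (f₀ , p₀) = toFun (proj₁ best) , proj₁ (proj₂ best) , λ g Pg →
      ℕ.≤-trans (proj₂ (proj₂ best) (fromFun g) (P-resp _ _ (λ i v → sym (to-from g i v)) Pg))
          (ℕ.≤-reflexive (μ-resp _ _ (to-from g)))
    where
    toFun : Vec (Vec (Fin n) n) b → Assignment b n
    toFun F i v = lookup (lookup F i) v
    fromFun : Assignment b n → Vec (Vec (Fin n) n) b
    fromFun f = tabulate λ i → tabulate (f i)
    to-from : ∀ f i v → toFun (fromFun f) i v ≡ f i v
    to-from f i v = trans (cong (λ u → lookup u v) (Vec.lookup∘tabulate (λ i → tabulate (f i)) i))
        (Vec.lookup∘tabulate (f i) v)
    best : ∃ λ F → P (toFun F) × (∀ F′ → P (toFun F′) → μ (toFun F) ≤ μ (toFun F′))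
    best = minimise (search-Vec (search-Vec Fin.any?)) (P? ∘ toFun) (μ ∘ toFun)
      (fromFun f₀ , P-resp _ _ (λ i v → sym (to-from f₀ i v)) p₀)

-- `h` is the load of a server before a token is passed and `g` the load afterwards; `d` says that
-- the server loses the token, `e` that it gains it. The three possible cases expand (h - 1)², (h +
-- 1)² and h².
square-shift : {A B : Set} (h g : ℕ) (d : Dec A) (e : Dec B) → (A → ¬ B) → g + ⟦ d ⟧ ≡ h + ⟦ e ⟧ →
  g * g + 2 * h * ⟦ d ⟧ ≡ h * h + 2 * h * ⟦ e ⟧ + (⟦ e ⟧ + ⟦ d ⟧)
square-shift h g (yes a) (yes b) excl _ = ⊥-elim (excl a b)
square-shift h g (yes _) (no _) _ eq with refl ← trans (sym (ℕ.+-identityʳ h)) (sym eq) = lem g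
  where
  lem : ∀ t → t * t + 2 * (t + 1) * 1 ≡ (t + 1) * (t + 1) + 2 * (t + 1) * 0 + 1
  lem = solve-∀
square-shift h g (no _) (yes _) _ eq with refl ← trans (sym (ℕ.+-identityʳ g)) eq = lem h
  where
  lem : ∀ t → (t + 1) * (t + 1) + 2 * t * 0 ≡ t * t + 2 * t * 1 + 1
  lem = solve-∀
square-shift h g (no _) (no _) _ eq with refl ← ℕ.+-cancelʳ-≡ 0 g h eq = lem h
  where
  lem : ∀ t → t * t + 2 * t * 0 ≡ t * t + 2 * t * 0 + 0
  lem = solve-∀

module Clients {n : ℕ} {C : Fin n → Set} (C? : Decidable C) where

  opaque
    unfolding #

    load : Assignment b n → Fin n → ℕ
    load f u = sum λ i → # λ v → C? v ×-dec (f i v Fin.≟ u)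

    load-cong : (f g : Assignment b n) → (∀ i v → f i v ≡ g i v) → ∀ u → load f u ≡ load g u
    load-cong f g h u = sum-cong-≗ λ i → sum-cong-≗ λ v → cong (λ w → ⟦ C? v ×-dec (w Fin.≟ u) ⟧) (h i v)

    load-move : (f : Assignment b n) (i : Fin b) {v : Fin n} → C v → ∀ y z →
      load (move f i v y) z + ⟦ f i v Fin.≟ z ⟧ ≡ load f z + ⟦ y Fin.≟ z ⟧
    load-move f i {v} Cv y z = begin
      load (move f i v y) z + ⟦ f i v Fin.≟ z ⟧
        ≡⟨ cong (load (move f i v y) z +_) (served (f i v)) ⟨
      load (move f i v y) z + ⟦ C? v ×-dec (f i v Fin.≟ z) ⟧
        ≡⟨ sum₂-change i v (λ j w ne → cong (λ u → ⟦ C? w ×-dec (u Fin.≟ z) ⟧) (move-other f i v y ne)) ⟩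
      load f z + ⟦ C? v ×-dec (move f i v y i v Fin.≟ z) ⟧
        ≡⟨ cong (load f z +_) (served (move f i v y i v)) ⟩
      load f z + ⟦ move f i v y i v Fin.≟ z ⟧
        ≡⟨ cong (λ u → load f z + ⟦ u Fin.≟ z ⟧) (move-same f i v y) ⟩
      load f z + ⟦ y Fin.≟ z ⟧ ∎
      where
      served : ∀ u → ⟦ C? v ×-dec (u Fin.≟ z) ⟧ ≡ ⟦ u Fin.≟ z ⟧
      served u = ⟦⟧-cong (C? v ×-dec (u Fin.≟ z)) (u Fin.≟ z) proj₂ (Cv ,_)

    -- The tokens arriving in `Z` are counted by server on the left and by sender on the right.
    -- After exchanging the sums, each token contributes only at its own server.
    load-total : {Z : Fin n → Set} (Z? : Decidable Z) (f : Assignment b n) →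
      sum (λ u → ⟦ Z? u ⟧ * load f u) ≡ sum (λ i → # λ v → C? v ×-dec Z? (f i v))
    load-total {b} {Z} Z? f = begin
      sum (λ u → ⟦ Z? u ⟧ * load f u)
        ≡⟨ sum-cong-≗ (λ u → trans (*-distribˡ-sum {b} ⟦ Z? u ⟧
            (λ i → # λ v → C? v ×-dec (f i v Fin.≟ u)))
                (sum-cong-≗ {n = b} λ i → *-distribˡ-sum {n} ⟦ Z? u ⟧
                    (λ v → ⟦ C? v ×-dec (f i v Fin.≟ u) ⟧))) ⟩
      sum (λ u → sum λ i → sum λ v → term u i v)
        ≡⟨ ∑-comm (λ u i → sum λ v → term u i v) ⟩
      sum (λ i → sum λ u → sum λ v → term u i v)
        ≡⟨ sum-cong-≗ (λ i → ∑-comm λ u v → term u i v) ⟩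
      sum (λ i → sum λ v → sum λ u → term u i v)
        ≡⟨ sum-cong-≗ {n = b} (λ i → sum-cong-≗ {n = n} λ v →
            trans (sum-single (f i v) (off i v)) (on-server i v)) ⟩
      sum (λ i → # λ v → C? v ×-dec Z? (f i v)) ∎
      where
      term : Fin n → Fin b → Fin n → ℕ
      term u i v = ⟦ Z? u ⟧ * ⟦ C? v ×-dec (f i v Fin.≟ u) ⟧
      off : ∀ i v u → u ≢ f i v → term u i v ≡ 0
      off i v u ne = trans (cong (⟦ Z? u ⟧ *_) (⟦⟧-no (C? v ×-dec (f i v Fin.≟ u)) (ne ∘ sym ∘ proj₂)))
          (ℕ.*-zeroʳ ⟦ Z? u ⟧)
      on-server : ∀ i v → term (f i v) i v ≡ ⟦ C? v ×-dec Z? (f i v) ⟧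
      on-server i v with Z? (f i v)
      ... | yes z = trans (ℕ.+-identityʳ _) (⟦⟧-cong (C? v ×-dec (f i v Fin.≟ f i v)) (C? v ×-dec yes z)
          (λ (c , _) → c , z) (λ (c , _) → c , refl))
      ... | no ¬z = sym (⟦⟧-no (C? v ×-dec no ¬z) (¬z ∘ proj₂))

    load₁ : (f : Assignment 1 n) (u : Fin n) → load f u ≡ # (λ v → C? v ×-dec (f zero v Fin.≟ u))
    load₁ f u = ℕ.+-identityʳ _

    load₂ : (f : Assignment 2 n) (u : Fin n) →
      load f u ≡ # (λ v → C? v ×-dec (f zero v Fin.≟ u)) + # (λ v → C? v ×-dec (f (suc zero) v Fin.≟ u))
    load₂ f u = cong (# (λ v → C? v ×-dec (f zero v Fin.≟ u)) +_) (ℕ.+-identityʳ _)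

    load-total₁ : {Z : Fin n → Set} (Z? : Decidable Z) (f : Assignment 1 n) →
      sum (λ u → ⟦ Z? u ⟧ * load f u) ≡ # (λ v → C? v ×-dec Z? (f zero v))
    load-total₁ Z? f = trans (load-total Z? f) (ℕ.+-identityʳ _)

    load-total₂ : {Z : Fin n → Set} (Z? : Decidable Z) (f : Assignment 2 n) →
      sum (λ u → ⟦ Z? u ⟧ * load f u) ≡ # (λ v → C? v ×-dec Z? (f zero v)) +
          # (λ v → C? v ×-dec Z? (f (suc zero) v))
    load-total₂ Z? f = trans (load-total Z? f) (cong (# (λ v → C? v ×-dec Z? (f zero v)) +_)
        (ℕ.+-identityʳ _))

  module Balanced {E : Fin n → Fin n → Set} (E? : ∀ v u → Dec (E v u)) where

    Valid : Assignment b n → Set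
    Valid f = ∀ i v → C v → E v (f i v)

    valid-move : {f : Assignment b n} → Valid f → ∀ i v y → E v y → Valid (move f i v y)
    valid-move {f = f} valid i v y e j w c with (j Fin.≟ i) ×-dec (w Fin.≟ v)
    ... | yes (refl , refl) = subst (E v) (sym (move-same f i v y)) e
    ... | no ne = subst (E w) (sym (move-other f i v y ne)) (valid j w c)

    potential : Assignment b n → ℕ
    potential f = sum λ u → load f u * load f u

    -- Passing a token from load s to load t changes the sum of squares by 2t - 2s + 2, which is at
    -- most -2 when s ≥ t + 2.
    potential-decreases : (f g : Assignment b n) (x a : Fin n) →
      (∀ z → load g z + ⟦ x Fin.≟ z ⟧ ≡ load f z + ⟦ a Fin.≟ z ⟧) → 2 + load f a ≤ load f x →
          potential g < potential f
    potential-decreases f g x a shift far = bound (potential g) (potential f) (load f x) (load f a) far total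
      where
      square : ∀ z → load g z * load g z + 2 * load f z * ⟦ x Fin.≟ z ⟧
                   ≡ load f z * load f z + 2 * load f z * ⟦ a Fin.≟ z ⟧ + (⟦ a Fin.≟ z ⟧ + ⟦ x Fin.≟ z ⟧)
      square z = square-shift (load f z) (load g z) (x Fin.≟ z) (a Fin.≟ z) excl (shift z)
        where
        excl : x ≡ z → a ≢ z
        excl refl refl = ℕ.1+n≰n (ℕ.≤-trans (ℕ.n≤1+n _) far)
      at : ∀ y (h : Fin n → ℕ) → sum (λ z → h z * ⟦ y Fin.≟ z ⟧) ≡ h y
      at y h = trans (sum-single y λ z z≢y → trans (cong (h z *_) (⟦⟧-no (y Fin.≟ z) (z≢y ∘ sym)))
          (ℕ.*-zeroʳ (h z)))
        (trans (cong (h y *_) (⟦⟧-yes (y Fin.≟ y) refl)) (ℕ.*-identityʳ (h y)))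
      one : ∀ y → sum (λ z → ⟦ y Fin.≟ z ⟧) ≡ 1
      one y = trans (sum-single y λ z z≢y → ⟦⟧-no (y Fin.≟ z) (z≢y ∘ sym)) (⟦⟧-yes (y Fin.≟ y) refl)
      total : potential g + 2 * load f x ≡ potential f + 2 * load f a + 2
      total = begin
        potential g + 2 * load f x
          ≡⟨ cong (potential g +_) (at x λ z → 2 * load f z) ⟨
        potential g + sum (λ z → 2 * load f z * ⟦ x Fin.≟ z ⟧)
          ≡⟨ ∑-distrib-+ (λ z → load g z * load g z) (λ z → 2 * load f z * ⟦ x Fin.≟ z ⟧) ⟨
        sum (λ z → load g z * load g z + 2 * load f z * ⟦ x Fin.≟ z ⟧)
          ≡⟨ sum-cong-≗ square ⟩
        sum (λ z → load f z * load f z + 2 * load f z * ⟦ a Fin.≟ z ⟧ + (⟦ a Fin.≟ z ⟧ + ⟦ x Fin.≟ z ⟧))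
          ≡⟨ ∑-distrib-+ (λ z → load f z * load f z + 2 * load f z * ⟦ a Fin.≟ z ⟧)
              (λ z → ⟦ a Fin.≟ z ⟧ + ⟦ x Fin.≟ z ⟧) ⟩
        sum (λ z → load f z * load f z + 2 * load f z * ⟦ a Fin.≟ z ⟧) + sum (λ z →
            ⟦ a Fin.≟ z ⟧ + ⟦ x Fin.≟ z ⟧)
          ≡⟨ cong₂ _+_ (trans (∑-distrib-+ (λ z → load f z * load f z)
              (λ z → 2 * load f z * ⟦ a Fin.≟ z ⟧)) (cong (potential f +_) (at a λ z → 2 * load f z)))
                       (trans (∑-distrib-+ (λ z → ⟦ a Fin.≟ z ⟧) (λ z → ⟦ x Fin.≟ z ⟧))
                           (cong₂ _+_ (one a) (one x))) ⟩
        potential f + 2 * load f a + 2 ∎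
      bound : ∀ p q s t → 2 + t ≤ s → p + 2 * s ≡ q + 2 * t + 2 → p < q
      bound p q s t l e = ℕ.+-cancelʳ-< (2 * t + 2) p q
          (ℕ.≤-trans (ℕ.m≤m+n _ 1) (ℕ.≤-trans (ℕ.≤-reflexive (l₁ p t))
              (ℕ.≤-trans (ℕ.+-monoʳ-≤ p (ℕ.*-monoʳ-≤ 2 l)) (ℕ.≤-reflexive (trans e (ℕ.+-assoc q _ _))))))
        where
        l₁ : ∀ p t → suc (p + (2 * t + 2)) + 1 ≡ p + 2 * (2 + t)
        l₁ = solve-∀

    -- Y stands for the servers from which a token can be passed on, step by step, to a server of load at most c.
    Downstream : Assignment b n → ℕ → (Fin n → Bool) → Set
    Downstream f c Y = (∀ w → load f w ≤ c → Is Y w) × (∀ w → Is Y w → load f w ≤ suc c)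
      × (∀ i v y → C v → E v y → Is Y y → Is Y (f i v))

    opaque

      -- One minimiser of the sum of squares serves all thresholds `c`. `Y` grows from the servers
      -- of load at most `c` by adding each server that holds a token whose client has an edge into
      -- `Y`. From every server of `Y` a unit of load can be rerouted to a server of load at most
      -- `c`; at load `c + 2` or more this would lower the potential.
      balanced : ∃ (Valid {b}) → ∃ λ (f : Assignment b n) → Valid f × (∀ c → ∃ (Downstream f c))
      balanced {b} (f₀ , v₀)
        with minAssignment {P = Valid}
               (λ f → Fin.all? λ i → Fin.all? λ v → C? v →-dec E? v (f i v))
               (λ f g h val i v c → subst (E v) (h i v) (val i v c))
               potential (λ f g h → sum-cong-≗ λ u → cong₂ _*_ (load-cong f g h u) (load-cong f g h u))
                   (f₀ , v₀)
      ... | f , val , best = f , val , down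
        where
        module _ (c : ℕ) where
          Rel : Fin n → Fin n → Set
          Rel y x = ∃ λ i → ∃ λ v → C v × f i v ≡ x × E v y
          -- The last clause keeps the tokens outside `Y` in place. So when a server `x` joins `Y`,
          -- its token is still at `x` after the rerouting from `y` and can be passed on to `y`.
          Reroute : (Fin n → Bool) → Fin n → Set
          Reroute Y y = ∃ λ (g : Assignment b n) → ∃ λ a → Valid g × load f a ≤ c
            × (∀ z → load g z + ⟦ y Fin.≟ z ⟧ ≡ load f z + ⟦ a Fin.≟ z ⟧)
            × (∀ i v → ¬ Is Y (f i v) → g i v ≡ f i v)
          Inv : (Fin n → Bool) → Set
          Inv Y = ∀ y → Is Y y → Reroute Y y
          step : ∀ Y y x → Inv Y → Is Y y → ¬ Is Y x → Rel y x → Inv (insert x Y)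
          step Y y x inv Yy ¬Yx (i , v , Cv , fv≡x , e) w Yw with insert⁻ x Y w Yw
          ... | inj₂ Yw′ with inv w Yw′
          ...   | g , a , val-g , small , shift , old = g , a , val-g , small , shift , λ j u nu →
              old j u (nu ∘ insert-old x Y _)
          step Y y x inv Yy ¬Yx (i , v , Cv , fv≡x , e) w Yw | inj₁ refl with inv y Yy
          ... | g , a , val-g , small , shift , old =
            move g i v y , a , valid-move val-g i v y e , small , shift′ ,
            λ j u nu → trans (move-other g i v y λ { (refl , refl) →
                nu (subst (Is (insert x Y)) (sym fv≡x) (insert-new x Y)) }) (old j u (nu ∘ insert-old x Y _))
            where
            gv≡x : g i v ≡ x
            gv≡x = trans (old i v (λ h → ¬Yx (subst (Is Y) fv≡x h))) fv≡x
            shift′ : ∀ z → load (move g i v y) z + ⟦ x Fin.≟ z ⟧ ≡ load f z + ⟦ a Fin.≟ z ⟧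
            shift′ z = trans (subst (λ u → load (move g i v y) z + ⟦ u Fin.≟ z ⟧ ≡ load g z + ⟦ y Fin.≟ z
                ⟧) gv≡x (load-move g i Cv y z)) (shift z)
          down : ∃ (Downstream f c)
          down with closure (λ y x → Fin.any? λ i → Fin.any? λ v →
              C? v ×-dec (f i v Fin.≟ x) ×-dec E? v y) Inv step
                      (λ w → does (load f w ℕ.≤? c))
                      (λ w low → f , w , val , does⁻ (load f w ℕ.≤? c) low , (λ _ → refl) , λ _ _ _ → refl)
          ... | Y , inv , base , closed = Y , (λ w l → base w (dec-true (load f w ℕ.≤? c) l)) , small ,
              λ i v y Cv e Yy → closed y (f i v) Yy (i , v , Cv , refl , e)
            where
            small : ∀ w → Is Y w → load f w ≤ suc c
            small w Yw with inv w Yw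
            ... | g , a , val-g , low , shift , _ with load f w ℕ.≤? suc c
            ... | yes l = l
            ... | no ¬l = ⊥-elim (ℕ.<⇒≱ (potential-decreases f g w a shift
                (ℕ.≤-trans (s≤s (s≤s low)) (ℕ.≰⇒> ¬l))) (best g val-g))

-- Extremal independent sets

module Neighbourhoods (G : Graph) where

  V : Set
  V = Fin (Graph.n G)

  Adj : V → V → Set
  Adj u v = adj G u v ≡ true

  adj? : ∀ u v → Dec (Adj u v)
  adj? u v = adj G u v Bool.≟ true

  Adj-sym : ∀ {u v} → Adj u v → Adj v u
  Adj-sym {u} {v} e = trans (Graph.sym G v u) e

  Adj-irrefl : ∀ {u} → ¬ Adj u u
  Adj-irrefl {u} e with trans (sym e) (Graph.irrefl G u)
  ... | ()

  N : (V → Set) → V → Set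
  N X u = ∃ λ v → X v × Adj v u

  N? : {X : V → Set} → Decidable X → Decidable (N X)
  N? X? u = Fin.any? λ v → X? v ×-dec adj? v u

  -- Says that `X` maximises |X| - |N(X)|, with the terms moved so that no subtraction occurs.
  Extremal : {X : V → Set} → Decidable X → Set₁
  Extremal X? = ∀ {X′ : V → Set} (X′? : Decidable X′) → # X′? + # (N? X?) ≤ # X? + # (N? X′?)

  #-complement : {X : V → Set} (X? : Decidable X) → # X? + # (λ v → ¬? (X? v)) ≡ # {P = λ (_ : V) → ⊤}
    (λ _ → yes tt)
  #-complement X? = ℕ.≤-antisym
    (#-disjoint X? (λ v → ¬? (X? v)) (λ _ → yes tt) _ _ λ _ x ¬x → ¬x x)
    (#-cover X? (λ v → ¬? (X? v)) (λ _ → yes tt) λ v _ → dec v (X? v))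
    where
    dec : ∀ v → Dec _ → _ ⊎ _
    dec v (yes x) = inj₁ x
    dec v (no ¬x) = inj₂ ¬x

  opaque

    extremal-set : ∃ λ (W : V → Bool) → Extremal (is? W)
    -- |N(W)| plus the number of vertices outside `W` differs from |N(W)| - |W| by the order of the
    -- graph, which is constant.
    extremal-set with minimise (search-Vec {Graph.n G} search-Bool) {P = λ _ → ⊤} (λ _ → yes tt)
          (λ W → # (N? (is? (lookup W))) + # (λ v → ¬? (is? (lookup W) v))) (tabulate (λ _ → false) , tt)
    ... | W , _ , best = lookup W , ext
      where
      ext : Extremal (is? (lookup W))
      ext {X′} X′? = exchange _ _ (# (N? (is? (lookup W)))) _ _ (# (N? X′?))
          (#-complement (is? (lookup W))) (#-complement X′?)
        (ℕ.≤-trans (best (tabulate (does ∘ X′?)) tt)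
          (ℕ.≤-reflexive (cong₂ _+_
            (#-cong (N? (is? (lookup W′))) (N? X′?) (λ { u (v , x , e) → v , from v x , e })
                (λ { u (v , x , e) → v , to v x , e }))
            (#-cong (λ v → ¬? (is? (lookup W′) v)) (λ v → ¬? (X′? v)) (λ v h → h ∘ to v)
                (λ v h → h ∘ from v)))))
        where
        W′ : Vec Bool (Graph.n G)
        W′ = tabulate (does ∘ X′?)
        from : ∀ v → Is (lookup W′) v → X′ v
        from v h = does⁻ (X′? v) (trans (sym (Vec.lookup∘tabulate (does ∘ X′?) v)) h)
        to : ∀ v → X′ v → Is (lookup W′) v
        to v x = trans (Vec.lookup∘tabulate (does ∘ X′?) v) (dec-true (X′? v) x)
        exchange : ∀ x x̄ nx y ȳ ny {t} → x + x̄ ≡ t → y + ȳ ≡ t → nx + x̄ ≤ ny + ȳ → y + nx ≤ x + ny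
        exchange x x̄ nx y ȳ ny {t} e₁ e₂ l = ℕ.+-cancelʳ-≤ t _ _
          (subst₂ _≤_ (trans (l₁ nx x̄ x y) (cong (y + nx +_) e₁))
              (trans (l₂ ny ȳ x y) (cong (x + ny +_) e₂)) (ℕ.+-monoˡ-≤ (x + y) l))
          where
          l₁ : ∀ nx x̄ x y → nx + x̄ + (x + y) ≡ y + nx + (x + x̄)
          l₁ = solve-∀
          l₂ : ∀ ny ȳ x y → ny + ȳ + (x + y) ≡ x + ny + (y + ȳ)
          l₂ = solve-∀

  Independent′ : (V → Set) → Set
  Independent′ X = ∀ u v → X u → X v → ¬ Adj u v

  -- Removing from an extremal set its points that have a neighbour in it keeps it extremal.
  extremal-independent-set : ∃ λ (I : V → Set) → Σ (Decidable I) λ I? → Independent′ I × Extremal I?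
  extremal-independent-set with extremal-set
  ... | W , ext = I , I? , (λ { u v (Wu , _) (_ , ¬Nv) e → ¬Nv (u , Wu , e) }) , ext′
    where
    I J : V → Set
    I v = Is W v × ¬ N (Is W) v
    J v = Is W v × N (Is W) v
    I? : Decidable I
    I? v = is? W v ×-dec ¬? (N? (is? W) v)
    J? : Decidable J
    J? v = is? W v ×-dec N? (is? W) v
    dec : ∀ v → Is W v → Dec (N (Is W) v) → I v ⊎ J v
    dec v w (yes h) = inj₂ (w , h)
    dec v w (no h)  = inj₁ (w , h)
    -- A vertex of `I` has no neighbour in `W`, so `N I` misses `J`, while `J` itself lies in
    -- `N (Is W)`. Dropping `J` thus costs no more points than it saves neighbours.
    N-split : # (N? I?) + # J? ≤ # (N? (is? W))
    N-split = #-disjoint (N? I?) J? (N? (is? W)) (λ { u (v , (Wv , _) , e) → v , Wv , e }) (λ _ → proj₂)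
      (λ { u (v , (_ , ¬Nv) , e) (Wu , _) → ¬Nv (u , Wu , Adj-sym e) })
    ext′ : Extremal I?
    ext′ X? = combine (# I?) (# J?) (# (is? W)) (# (N? I?)) (# (N? (is? W))) (# X?) (# (N? X?))
      (#-cover I? J? (is? W) (λ v w → dec v w (N? (is? W) v))) N-split (ext X?)
      where
      combine : ∀ i j w ni nw x nx → w ≤ i + j → ni + j ≤ nw → x + nw ≤ w + nx → x + ni ≤ i + nx
      combine i j w ni nw x nx a b c = ℕ.+-cancelʳ-≤ j _ _
        (ℕ.≤-trans (ℕ.≤-reflexive (ℕ.+-assoc x ni j)) (ℕ.≤-trans (ℕ.+-monoʳ-≤ x b) (ℕ.≤-trans c
          (ℕ.≤-trans (ℕ.+-monoˡ-≤ nx a) (ℕ.≤-reflexive (lem i j nx))))))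
        where
        lem : ∀ i j nx → i + j + nx ≡ i + nx + j
        lem = solve-∀

-- Tokens on the extremal set, and expansion of the remaining vertices.

module _ (G : Graph) where

  open Neighbourhoods G

  module Distribution (k : ℕ)
    (wide : {X : V → Set} (X? : Decidable X) → Independent′ X → 2 * # X? ≤ (2 * k + 1) * # (N? X?))
    (neighbour : ∀ v → ∃ (Adj v))
    {I : V → Set} (I? : Decidable I) (indep : Independent′ I) (ext : Extremal I?) where

    A R : V → Set
    A = N I
    R v = ¬ I v × ¬ A v

    A? : Decidable A
    A? = N? I?
    R? : Decidable R
    R? v = ¬? (I? v) ×-dec ¬? (A? v)

    I∩A : ∀ {v} → I v → ¬ A v
    I∩A {v} i (u , j , e) = indep u v j i e

    module IC = Clients I?
    module IB = IC.Balanced adj?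

    I-assignment : ∃ λ (f : Assignment 2 _) → (∀ i v → I v → Adj v (f i v))
      × (∀ u → IC.load f u ≤ 2 * k + 1) × (∀ u → A u → 1 ≤ IC.load f u)
    I-assignment with IB.balanced ((λ i v → proj₁ (neighbour v)) , λ i v _ → proj₂ (neighbour v))
    ... | f , valid , down = f , valid , upper , lower
      where
      upper : ∀ u → IC.load f u ≤ 2 * k + 1
      upper u with IC.load f u ℕ.≤? 2 * k + 1
      ... | yes l = l
      -- Loads in `Y` are at most 2k + 1, so `u` lies outside; there all loads are at least 2k + 1
      -- and that of `u` is larger. A client with a token outside `Y` has no neighbour in `Y`, so
      -- both tokens and all neighbours of the clients in `X` are in `Z`. Hence (2k + 1)|Z| < 2|X|,
      -- against `wide`.
      ... | no ¬l with down (2 * k)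
      ...   | Y , low , small , closed =
          ⊥-elim (ℕ.<⇒≱ crowded (ℕ.≤-trans (wide X? indep-X)
              (ℕ.*-monoʳ-≤ (2 * k + 1) (#-mono (N? X?) Z? N⊆Z))))
        where
        Z X : V → Set
        Z v = ¬ Is Y v
        X v = I v × Z (f zero v)
        Z? : Decidable Z
        Z? v = ¬? (is? Y v)
        X? : Decidable X
        X? v = I? v ×-dec Z? (f zero v)
        indep-X : Independent′ X
        indep-X v w (i , _) (j , _) = indep v w i j
        N⊆Z : ∀ w → N X w → Z w
        N⊆Z w (v , (Iv , z) , e) Yw = z (closed zero v w Iv e Yw)
        Z-load : sum (λ v → ⟦ Z? v ⟧ * IC.load f v) ≡ 2 * # X?
        Z-load = trans (IC.load-total₂ Z? f) (cong (# X? +_) (trans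
          (#-cong (λ v → I? v ×-dec Z? (f (suc zero) v)) X?
            (λ { v (Iv , z) → Iv , λ Yv → z (closed (suc zero) v _ Iv (valid zero v Iv) Yv) })
            (λ { v (Iv , z) → Iv , λ Yv → z (closed zero v _ Iv (valid (suc zero) v Iv) Yv) }))
          (sym (ℕ.+-identityʳ (# X?)))))
        full : ∀ v → Z v → 2 * k + 1 ≤ IC.load f v
        full v z = subst (_≤ IC.load f v) (ℕ.+-comm 1 (2 * k)) (ℕ.≰⇒> (z ∘ low v))
        u∈Z : Z u
        u∈Z Yu = ¬l (subst (IC.load f u ≤_) (ℕ.+-comm 1 (2 * k)) (small u Yu))
        crowded : (2 * k + 1) * # Z? < 2 * # X?
        crowded = subst ((2 * k + 1) * # Z? <_) Z-load (weight-above Z? (2 * k + 1) (IC.load f) full u u∈Z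
            (ℕ.≰⇒> ¬l))
      lower : ∀ u → A u → 1 ≤ IC.load f u
      lower u Au with 1 ℕ.≤? IC.load f u
      ... | yes l = l
      -- Loads in `Y` are at most 1, and the idle `u` is in `Y`. The clients `X` with a neighbour in
      -- `Y` send both tokens into Y ∩ A, so 2|X| < |Y ∩ A|. Removing `X` from `I` loses all
      -- neighbours in Y ∩ A, so extremality gives |Y ∩ A| ≤ |X|.
      ... | no ¬l with down 0
      ...   | Y , low , small , closed = ⊥-elim (ℕ.<⇒≱ starved (ℕ.≤-trans (#-YA≤X) (ℕ.m≤n*m (# X?) 2)))
        where
        YA X I′ : V → Set
        YA v = Is Y v × A v
        X v = I v × ∃ λ y → Is Y y × Adj v y
        I′ v = I v × ¬ X v
        YA? : Decidable YA
        YA? v = is? Y v ×-dec A? v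
        X? : Decidable X
        X? v = I? v ×-dec Fin.any? λ y → is? Y y ×-dec adj? v y
        I′? : Decidable I′
        I′? v = I? v ×-dec ¬? (X? v)
        dec : ∀ v → I v → Dec (X v) → I′ v ⊎ X v
        dec v i (yes x) = inj₂ x
        dec v i (no ¬x) = inj₁ (i , ¬x)
        #-YA≤X : # YA? ≤ # X?
        #-YA≤X = combine (# I′?) (# A?) (# I?) (# (N? I′?)) (# YA?) (# X?) (ext I′?)
            (#-cover I′? X? I? λ v i → dec v i (X? v))
          (#-disjoint (N? I′?) YA? A? (λ { w (v , (i , _) , e) → v , i , e }) (λ _ → proj₂)
            (λ { w (v , (i , ¬x) , e) (Yw , _) → ¬x (i , w , Yw , e) }))
          where
          combine : ∀ i′ a i ni y x → i′ + a ≤ i + ni → i ≤ i′ + x → ni + y ≤ a → y ≤ x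
          combine i′ a i ni y x p q r = ℕ.+-cancelˡ-≤ (i′ + ni) _ _
            (ℕ.≤-trans (ℕ.≤-reflexive (ℕ.+-assoc i′ ni y)) (ℕ.≤-trans (ℕ.+-monoʳ-≤ i′ r) (ℕ.≤-trans p
              (ℕ.≤-trans (ℕ.+-monoˡ-≤ ni q) (ℕ.≤-reflexive (lem i′ x ni))))))
            where
            lem : ∀ a b c → a + b + c ≡ a + c + b
            lem = solve-∀
        X-served : ∀ i → # X? ≤ # (λ v → I? v ×-dec YA? (f i v))
        X-served i = #-mono X? (λ v → I? v ×-dec YA? (f i v))
          λ { v (Iv , y , Yy , e) → Iv , closed i v y Iv e Yy , v , Iv , valid i v Iv }
        starved : 2 * # X? < # YA?
        starved = ℕ.≤-<-trans
          (subst (2 * # X? ≤_) (sym (IC.load-total₂ YA? f))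
              (ℕ.≤-trans (ℕ.≤-reflexive (cong (# X? +_) (ℕ.+-identityʳ (# X?))))
                  (ℕ.+-mono-≤ (X-served zero) (X-served (suc zero)))))
          (subst (sum (λ v → ⟦ YA? v ⟧ * IC.load f v) <_) (ℕ.*-identityˡ (# YA?))
            (weight-below YA? 1 (IC.load f) (λ v → small v ∘ proj₁) u (low u (s≤s⁻¹ (ℕ.≰⇒> ¬l)) , Au)
                (ℕ.≰⇒> ¬l)))

    module RC = Clients R?
    module RB = RC.Balanced (λ v u → adj? v u ×-dec R? u)

    I∪ : (V → Set) → V → Set
    I∪ X v = I v ⊎ X v

    I∪? : {X : V → Set} → Decidable X → Decidable (I∪ X)
    I∪? X? v = I? v ⊎-dec X? v

    -- Extremality of `I` is tested against I ∪ X, whose neighbourhood lies in A ∪ Z: a neighbour of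
    -- `X` outside `A` is not in `I`, as otherwise `X` would meet `A`, and so it is in `R`.
    expansion : {X Z : V → Set} (X? : Decidable X) (Z? : Decidable Z) → (∀ v → X v → R v) →
      (∀ v w → X v → R w → Adj v w → Z w) → # X? ≤ # Z?
    expansion {X} {Z} X? Z? X⊆R N⊆Z = combine (# (I∪? X?)) (# A?) (# I?) (# (N? (I∪? X?))) (# X?) (# Z?)
        (ext (I∪? X?)) (#-disjoint I? X? (I∪? X?) (λ _ → inj₁) (λ _ → inj₂) (λ v i x → proj₁ (X⊆R v x) i))
        (#-cover A? Z? (N? (I∪? X?)) λ { w (v , inj₁ i , e) → inj₁ (v , i , e) ; w (v , inj₂ x , e) →
            nbr v w x e (A? w) })
      where
      nbr : ∀ v w → X v → Adj v w → Dec (A w) → A w ⊎ Z w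
      nbr v w x e (yes a) = inj₁ a
      nbr v w x e (no ¬a) = inj₂ (N⊆Z v w x ((λ i → proj₂ (X⊆R v x) (w , i , Adj-sym e)) , ¬a) e)
      combine : ∀ ix a i nix x z → ix + a ≤ i + nix → i + x ≤ ix → nix ≤ a + z → x ≤ z
      combine ix a i nix x z p q r = ℕ.+-cancelˡ-≤ (i + a) _ _
        (ℕ.≤-trans (ℕ.≤-reflexive (lem i a x)) (ℕ.≤-trans (ℕ.+-monoˡ-≤ a q)
            (ℕ.≤-trans p (ℕ.≤-trans (ℕ.+-monoʳ-≤ i r) (ℕ.≤-reflexive (sym (ℕ.+-assoc i a z)))))))
        where
        lem : ∀ a b c → a + b + c ≡ a + c + b
        lem = solve-∀

    -- Without a neighbour in `R`, `expansion` for the singleton of `v` and the empty set would give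
    -- 1 ≤ 0.
    R-neighbour : ∀ v → R v → ∃ λ u → Adj v u × R u
    R-neighbour v r with Fin.any? (λ u → adj? v u ×-dec R? u)
    ... | yes h = h
    ... | no h = ⊥-elim (ℕ.1+n≰n (subst (_≤ 0) (#-single (λ w → w Fin.≟ v) v refl (λ _ → id))
        (ℕ.≤-trans (expansion {Z = λ _ → ⊥} (λ w → w Fin.≟ v) (λ _ → no id) (λ { _ refl → r })
            (λ { _ w refl Rw e → h (w , e , Rw) }))
          (ℕ.≤-reflexive (#-empty {Graph.n G} (λ _ → no id) λ _ → id)))))

    R-injection : ∃ λ (π : V → V) → (∀ v → R v → Adj v (π v) × R (π v)) ×
      (∀ v w → R v → R w → π v ≡ π w → v ≡ w)
    R-injection with RB.balanced {1} ((λ _ v → start v (R? v)) , λ _ v r → start-ok v (R? v) r)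
      where
      start : ∀ v → Dec (R v) → V
      start v (yes r) = proj₁ (R-neighbour v r)
      -- A default value: vertices outside `R` are not clients here.
      start v (no _)  = v
      start-ok : ∀ v (d : Dec (R v)) → R v → Adj v (start v d) × R (start v d)
      start-ok v (yes r) _ = proj₂ (R-neighbour v r)
      start-ok v (no ¬r) r = ⊥-elim (¬r r)
    ... | f , valid , down = f zero , valid zero , inj
      where
      at-most-one : ∀ u → RC.load f u ≤ 1
      at-most-one u with RC.load f u ℕ.≤? 1
      ... | yes l = l
      -- In `Z`, the part of `R` outside `Y`, all loads are at least 1 and that of `u` is at least
      -- 2, so more than |Z| vertices `X` send their token into `Z`. The neighbours of `X` in `R`
      -- lie in `Z`, which contradicts `expansion`.
      ... | no ¬l with down 0
      ...   | Y , low , small , closed = ⊥-elim (ℕ.<⇒≱ crowded (expansion X? Z? (λ _ → proj₁)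
                λ { v w (r , z) Rw e → Rw , λ Yw → proj₂ z (closed zero v w r (e , Rw) Yw) }))
        where
        Z X : V → Set
        Z v = R v × ¬ Is Y v
        X v = R v × Z (f zero v)
        Z? : Decidable Z
        Z? v = R? v ×-dec ¬? (is? Y v)
        X? : Decidable X
        X? v = R? v ×-dec Z? (f zero v)
        u∈Z : Z u
        u∈Z with #-witness (λ v → R? v ×-dec (f zero v Fin.≟ u))
            (subst (0 <_) (RC.load₁ f u) (ℕ.<-trans (s≤s z≤n) (ℕ.≰⇒> ¬l)))
        ... | v , r , refl = proj₂ (valid zero v r) , λ Yu → ¬l (small u Yu)
        crowded : # Z? < # X?
        crowded = subst₂ _<_ (ℕ.*-identityˡ (# Z?)) (RC.load-total₁ Z? f)
          (weight-above Z? 1 (RC.load f) (λ { v (_ , ¬Y) → ℕ.≰⇒> (¬Y ∘ low v) }) u u∈Z (ℕ.≰⇒> ¬l))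
      inj : ∀ v w → R v → R w → f zero v ≡ f zero w → v ≡ w
      inj v w Rv Rw eq with v Fin.≟ w
      ... | yes e = e
      ... | no v≢w = ⊥-elim (ℕ.1+n≰n (ℕ.≤-trans (ℕ.≤-reflexive (sym (cong₂ _+_ (single v) (single w))))
            (ℕ.≤-trans (#-disjoint (λ x → x Fin.≟ v) (λ x → x Fin.≟ w)
                (λ x → R? x ×-dec (f zero x Fin.≟ f zero w))
              (λ { _ refl → Rv , eq }) (λ { _ refl → Rw , refl }) (λ { _ refl → v≢w }))
            (subst (_≤ 1) (RC.load₁ f (f zero w)) (at-most-one (f zero w))))))
        where
        single : ∀ a → # (λ x → x Fin.≟ a) ≡ 1
        single a = #-single (λ x → x Fin.≟ a) a refl (λ _ → id)

-- Assignments with few split clients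

opposite : Fin 2 → Fin 2
opposite zero       = suc zero
opposite (suc zero) = zero

opposite-involutive : ∀ i → opposite (opposite i) ≡ i
opposite-involutive zero       = refl
opposite-involutive (suc zero) = refl

opposite-≢ : ∀ i → opposite i ≢ i
opposite-≢ zero ()
opposite-≢ (suc zero) ()

this-or-opposite : ∀ i j → j ≡ i ⊎ j ≡ opposite i
this-or-opposite zero       zero       = inj₁ refl
this-or-opposite zero       (suc zero) = inj₂ refl
this-or-opposite (suc zero) zero       = inj₂ refl
this-or-opposite (suc zero) (suc zero) = inj₁ refl

last : {A : Set} → A → List A → A
last x []       = x
last x (y ∷ ys) = last y ys

last-All : {A : Set} {P : A → Set} → ∀ x xs → All P (x ∷ xs) → P (last x xs)
last-All x []       (p ∷ _)  = p
last-All x (y ∷ ys) (_ ∷ ps) = last-All y ys ps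

Linked-snoc⁻ : {A : Set} {_~_ : A → A → Set} → ∀ x xs z → Linked _~_ (x ∷ xs ++ z ∷ []) →
  Linked _~_ (x ∷ xs) × last x xs ~ z
Linked-snoc⁻ x []       z (r ∷ _)  = [-] , r
Linked-snoc⁻ x (y ∷ ys) z (r ∷ rs) with Linked-snoc⁻ y ys z rs
... | l , e = r ∷ l , e

Linked-map-All : {A : Set} {P : A → Set} {_~_ _≈_ : A → A → Set} →
  (∀ a b → P a → P b → a ~ b → a ≈ b) → ∀ {l} → All P l → Linked _~_ l → Linked _≈_ l
Linked-map-All f _ [] = []
Linked-map-All f _ [-] = [-]
Linked-map-All f (p ∷ q ∷ ps) (r ∷ rs) = f _ _ p q r ∷ Linked-map-All f (q ∷ ps) rs

module Splitting {n : ℕ} {I A : Fin n → Set} (I? : Decidable I) (A? : Decidable A)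
  {E : Fin n → Fin n → Set} (E? : ∀ v u → Dec (E v u)) (c : ℕ) where

  open Clients I?
  open Balanced E?

  Feasible : Assignment 2 n → Set
  Feasible f = Valid f × (∀ u → load f u ≤ c) × (∀ u → A u → 1 ≤ load f u)

  Split : Assignment 2 n → Fin n → Set
  Split f v = I v × f zero v ≢ f (suc zero) v

  Split? : ∀ f → Decidable (Split f)
  Split? f v = I? v ×-dec ¬? (f zero v Fin.≟ f (suc zero) v)

  splits : Assignment 2 n → ℕ
  splits f = # (Split? f)

  Joins : Assignment 2 n → Fin n → Fin n → Fin n → Set
  Joins f v x y = I v × x ≢ y × ∃ λ i → f i v ≡ x × f (opposite i) v ≡ y

  Joins? : ∀ f v x y → Dec (Joins f v x y)
  Joins? f v x y = I? v ×-dec ¬? (x Fin.≟ y) ×-dec Fin.any? λ i →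
      (f i v Fin.≟ x) ×-dec (f (opposite i) v Fin.≟ y)

  Joins-sym : ∀ {f v x y} → Joins f v x y → Joins f v y x
  Joins-sym {f} {v} (Iv , ne , i , p , q) = Iv , ne ∘ sym , opposite i , q , trans
      (cong (λ j → f j v) (opposite-involutive i)) p

  Joins-server : ∀ {f v x y} → Joins f v x y → ∀ i → f i v ≡ x ⊎ f i v ≡ y
  Joins-server {f} {v} (_ , _ , i , p , q) j with this-or-opposite i j
  ... | inj₁ refl = inj₁ p
  ... | inj₂ refl = inj₂ q

  Joins-split : ∀ {f v x y} → Joins f v x y → f zero v ≢ f (suc zero) v
  Joins-split (_ , ne , zero , p , q) e = ne (trans (sym p) (trans e q))
  Joins-split (_ , ne , suc zero , p , q) e = ne (trans (sym p) (trans (sym e) q))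

  H : Assignment 2 n → Fin n → Fin n → Set
  H f x y = ∃ λ v → Joins f v x y

  H? : ∀ f x y → Dec (H f x y)
  H? f x y = Fin.any? λ v → Joins? f v x y

  -- The net effect of carrying one unit of load from `from` to `to`, possibly through several
  -- clients, without increasing the number of split clients.
  record Shift (f g : Assignment 2 n) (from to : Fin n) : Set where
    field
      valid : Valid f → Valid g
      loads : ∀ z → load g z + ⟦ from Fin.≟ z ⟧ ≡ load f z + ⟦ to Fin.≟ z ⟧
      fewer : splits g ≤ splits f

  solidify : ∀ f v x y → Joins f v x y → ∃ λ g → Shift f g y x × splits g < splits f
    × (∀ j w → w ≢ v → g j w ≡ f j w)
  solidify f v x y (Iv , x≢y , i , refl , refl) = g , record
      { valid = val ; loads = λ z → load-move f (opposite i) Iv (f i v) z ; fewer = ℕ.<⇒≤ strict }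
      , strict , λ j w w≢v → other j w w≢v
    where
    g : Assignment 2 n
    g = move f (opposite i) v (f i v)
    other : ∀ j w → w ≢ v → g j w ≡ f j w
    other j w w≢v = move-other f (opposite i) v (f i v) (w≢v ∘ proj₂)
    val : Valid f → Valid g
    val valid = valid-move valid (opposite i) v (f i v) (valid i v Iv)
    solid : ∀ j → g j v ≡ f i v
    solid j with this-or-opposite i j
    ... | inj₁ refl = move-other f (opposite i) v (f i v) (opposite-≢ i ∘ sym ∘ proj₁)
    ... | inj₂ refl = move-same f (opposite i) v (f i v)
    old : ∀ w → Split g w → Split f w
    old w (Iw , ne) = go (w Fin.≟ v)
      where
      go : Dec (w ≡ v) → Split f w
      go (yes refl) = ⊥-elim (ne (trans (solid zero) (sym (solid (suc zero)))))
      go (no w≢v)   = Iw , subst₂ _≢_ (other zero w w≢v) (other (suc zero) w w≢v) ne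
    strict : splits g < splits f
    strict = #-mono-< (Split? g) (Split? f) old v (Iv , Joins-split {f} (Iv , x≢y , i , refl , refl))
      (λ (_ , ne) → ne (trans (solid zero) (sym (solid (suc zero)))))

  -- The client of each edge becomes solid at the earlier of its two servers. Gains and losses
  -- cancel at inner vertices, so one unit moves from the last vertex to the first.
  shift-path : ∀ f x xs → Linked (H f) (x ∷ xs) → Unique (x ∷ xs) → ∃ λ g → Shift f g (last x xs) x
  shift-path f x [] _ _ = f , record { valid = id ; loads = λ _ → refl ; fewer = ℕ.≤-refl }
  shift-path f x (y ∷ ys) ((v , joins) ∷ linked) (x∉ys ∷ unique) with solidify f v x y joins
  ... | f₁ , s₁ , _ , other with shift-path f₁ y ys (Linked-map-All keep x∉ys linked) unique
    where
    -- The client just made solid serves `x`, and the remaining path avoids `x`; so it joins no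
    -- later pair, and the later edges survive in `f₁`.
    keep : ∀ a b → x ≢ a → x ≢ b → H f a b → H f₁ a b
    keep a b x≢a x≢b (w , Iw , a≢b , i , refl , refl) =
        w , Iw , a≢b , i , other i w w≢v , other (opposite i) w w≢v
      where
      w≢v : w ≢ v
      w≢v refl with proj₂ (proj₂ joins)
      ... | j , p , q with this-or-opposite i j
      ... | inj₁ refl = x≢a (sym p)
      ... | inj₂ refl = x≢b (sym p)
  ... | g , s₂ = g , record
    { valid = Shift.valid s₂ ∘ Shift.valid s₁
    ; loads = λ z → trans (Shift.loads s₂ z) (Shift.loads s₁ z)
    ; fewer = ℕ.≤-trans (Shift.fewer s₂) (Shift.fewer s₁) }

  Minimal : Assignment 2 n → Set
  Minimal f = Feasible f × (∀ g → Feasible g → splits f ≤ splits g)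

  opaque

    minimal : ∃ Feasible → ∃ Minimal
    minimal = minAssignment
      (λ f → Fin.all? (λ i → Fin.all? λ v → I? v →-dec E? v (f i v))
             ×-dec Fin.all? (λ u → load f u ℕ.≤? c) ×-dec Fin.all? (λ u → A? u →-dec (1 ℕ.≤? load f u)))
      (λ f g h (val , up , low) → (λ i v Iv → subst (E v) (h i v) (val i v Iv))
         , (λ u → subst (_≤ c) (load-cong f g h u) (up u)) , λ u a →
             subst (1 ≤_) (load-cong f g h u) (low u a))
      splits (λ f g h → #-cong (Split? f) (Split? g)
        (λ v (Iv , ne) → Iv , subst₂ _≢_ (h zero v) (h (suc zero) v) ne)
        (λ v (Iv , ne) → Iv , subst₂ _≢_ (sym (h zero v)) (sym (h (suc zero) v)) ne))

  module MinimalProperties {f : Assignment 2 n} (min : Minimal f) (E⇒A : ∀ v u → I v → E v u → A u)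
      (1<c : 1 < c) where

    private
      valid : Valid f
      valid = proj₁ (proj₁ min)
      upper : ∀ u → load f u ≤ c
      upper = proj₁ (proj₂ (proj₁ min))
      lower : ∀ u → A u → 1 ≤ load f u
      lower = proj₂ (proj₂ (proj₁ min))

    -- Making `v` solid at `x` moves a token from `y` to `x`. With room at `x` and a token to spare
    -- at `y` the result would be feasible with fewer split clients.
    no-transfer : ∀ v x y → Joins f v x y → load f x < c → ¬ 2 ≤ load f y
    no-transfer v x y joins room spare with solidify f v x y joins
    ... | g , s , strict , _ = ℕ.<⇒≱ strict (proj₂ min g (Shift.valid s valid , up , low))
      where
      up : ∀ u → load g u ≤ c
      up u = go (y Fin.≟ u) (x Fin.≟ u) (Shift.loads s u)
        where
        go : (d : Dec (y ≡ u)) (e : Dec (x ≡ u)) → load g u + ⟦ d ⟧ ≡ load f u + ⟦ e ⟧ → load g u ≤ c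
        go d (yes refl) eq = ℕ.≤-trans (ℕ.m≤m+n _ _) (ℕ.≤-trans (ℕ.≤-reflexive eq)
            (subst (_≤ c) (ℕ.+-comm 1 _) room))
        go d (no _) eq = ℕ.≤-trans (ℕ.m≤m+n _ _) (ℕ.≤-trans (ℕ.≤-reflexive (trans eq (ℕ.+-identityʳ _)))
            (upper u))
      low : ∀ u → A u → 1 ≤ load g u
      low u a = go (y Fin.≟ u) (x Fin.≟ u) (Shift.loads s u)
        where
        go : (d : Dec (y ≡ u)) (e : Dec (x ≡ u)) → load g u + ⟦ d ⟧ ≡ load f u + ⟦ e ⟧ → 1 ≤ load g u
        go (no _) e eq = ℕ.≤-trans (lower u a) (ℕ.≤-trans (ℕ.m≤m+n _ _)
            (ℕ.≤-reflexive (trans (sym eq) (ℕ.+-identityʳ _))))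
        go (yes refl) e eq = s≤s⁻¹
            (ℕ.≤-trans spare (ℕ.≤-trans (ℕ.m≤m+n _ _) (ℕ.≤-reflexive (trans (sym eq) (ℕ.+-comm _ 1)))))

    -- `no-transfer` is used in both directions: a server below `c` forces its partner down to load
    -- 1, which by `1<c` is again below `c` and forces the first down to 1.
    split-loads : ∀ v x y → Joins f v x y → (load f x ≡ c × load f y ≡ c) ⊎ (load f x ≡ 1 × load f y ≡ 1)
    split-loads v x y joins@(Iv , _ , i , refl , refl) with load f x ℕ.<? c
    ... | yes room = inj₂ (x-one , y-one)
      where
      one : ∀ z → A z → ¬ 2 ≤ load f z → load f z ≡ 1
      one z a h = ℕ.≤-antisym (s≤s⁻¹ (ℕ.≰⇒> h)) (lower z a)
      y-one : load f y ≡ 1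
      y-one = one y (E⇒A v y Iv (valid (opposite i) v Iv)) (no-transfer v x y joins room)
      x-one : load f x ≡ 1
      x-one = one x (E⇒A v x Iv (valid i v Iv)) (no-transfer v y x (Joins-sym {f} joins)
          (subst (_< c) (sym y-one) 1<c))
    ... | no full = inj₁ (x-full , ℕ.≤-antisym (upper y) (ℕ.≮⇒≥ λ room →
            no-transfer v y x (Joins-sym {f} joins) room (subst (2 ≤_) (sym x-full) 1<c)))
      where
      x-full : load f x ≡ c
      x-full = ℕ.≤-antisym (upper x) (ℕ.≮⇒≥ full)

    -- Around a cycle every client can be made solid at the server preceding it, which preserves all loads.
    no-closed-path : ∀ v x xs → Joins f v (last x xs) x →
      Linked (λ a b → ∃ λ w → w ≢ v × Joins f w a b) (x ∷ xs) → Unique (x ∷ xs) → ⊥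
    no-closed-path v x xs joins linked unique with solidify f v (last x xs) x joins
    ... | f₁ , s₁ , strict , other with shift-path f₁ x xs (Linked.map keep linked) unique
      where
      keep : ∀ {a b} → (∃ λ w → w ≢ v × Joins f w a b) → H f₁ a b
      keep (w , w≢v , Iw , ne , i , p , q) = w , Iw , ne , i , trans (other i w w≢v) p , trans
          (other (opposite i) w w≢v) q
    ... | g , s₂ = ℕ.<⇒≱ (ℕ.≤-<-trans (Shift.fewer s₂) strict)
        (proj₂ min g (Shift.valid s₂ (Shift.valid s₁ valid) ,
            (λ u → subst (_≤ c) (sym (same u)) (upper u)) , λ u a → subst (1 ≤_) (sym (same u)) (lower u a)))
      where
      same : ∀ z → load g z ≡ load f z
      same z = ℕ.+-cancelʳ-≡ ⟦ last x xs Fin.≟ z ⟧ _ _ (trans (Shift.loads s₂ z) (Shift.loads s₁ z))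

    -- Two different clients with the same servers form a closed path of length two.
    -- `no-closed-path` covers it because it speaks of clients rather than of edges of `H`.
    no-parallel : ∀ v w x y → Joins f v x y → Joins f w x y → v ≡ w
    no-parallel v w x y jv jw with w Fin.≟ v
    ... | yes e = sym e
    ... | no w≢v = ⊥-elim (no-closed-path v x (y ∷ []) (Joins-sym {f} jv) ((w , w≢v , jw) ∷ [-])
        ((proj₁ (proj₂ jv) ∷ []) ∷ ([] ∷ [])))

    -- The client `v` of the closing edge must differ from the clients of the other edges. It serves
    -- `x` and the last vertex; the edges after the first avoid `x`, and the first ends at `y`,
    -- which is not the last vertex because the cycle has at least three.
    H-acyclic : ∀ x xs → 2 ≤ length xs → Unique (x ∷ xs) → Linked (H f) (x ∷ xs ++ x ∷ []) → ⊥
    H-acyclic x (y ∷ []) (s≤s ()) _ _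
    H-acyclic x (y ∷ z ∷ zs) _ unique@((x≢y ∷ x∉) ∷ (y∉ ∷ _)) linked with Linked-snoc⁻ x (y ∷ z ∷ zs) x linked
    ... | (w , jw) ∷ linked′ , v , jv = no-closed-path v x (y ∷ z ∷ zs) jv
        ((w , first , jw) ∷ Linked-map-All later (x≢y ∷ x∉) linked′) unique
      where
      first : w ≢ v
      first refl with proj₂ (proj₂ jv)
      ... | i , p , _ with Joins-server {f} jw i
      ... | inj₁ e = proj₁ (proj₂ jv) (trans (sym p) e)
      ... | inj₂ e = last-All z zs y∉ (trans (sym e) p)
      later : ∀ a b → x ≢ a → x ≢ b → H f a b → ∃ λ u → u ≢ v × Joins f u a b
      later a b x≢a x≢b (u , ju) = u , clash , ju
        where
        clash : u ≡ v → ⊥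
        clash refl with proj₂ (proj₂ jv)
        ... | i , _ , q with Joins-server {f} ju (opposite i)
        ... | inj₁ e = x≢a (trans (sym q) e)
        ... | inj₂ e = x≢b (trans (sym q) e)

-- Bijective counting, and numbering of decidable sets.

opaque
  unfolding #

  #-partition : (S? : Decidable S) (P? : Decidable P) (Q? : Decidable Q) →
    (∀ x → S x → P x ⊎ Q x) → (∀ x → P x → S x) → (∀ x → Q x → S x) → (∀ x → P x → ¬ Q x) → # S? ≡ # P? + # Q?
  #-partition S? P? Q? f g h d = ℕ.≤-antisym (#-cover P? Q? S? f) (#-disjoint P? Q? S? g h d)

  -- The related pairs are counted by rows and by columns; each element of `P` and each of `Q`
  -- occurs in exactly one pair.
  #-matching : {P : Fin m → Set} {Q : Fin n → Set} (P? : Decidable P) (Q? : Decidable Q)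
    {_~_ : Fin m → Fin n → Set} (~? : ∀ x y → Dec (x ~ y)) →
    (∀ x y → x ~ y → P x × Q y) → (∀ x → P x → ∃ (x ~_)) → (∀ y → Q y → ∃ (_~ y)) →
    (∀ x y z → x ~ y → x ~ z → y ≡ z) → (∀ x y z → x ~ z → y ~ z → x ≡ y) → # P? ≡ # Q?
  #-matching {m} {n} {P} {Q} P? Q? {_~_} ~? sound left right functional injective = begin
    # P?                                  ≡⟨ sum-cong-≗ {m} (λ x → row x (P? x)) ⟩
    sum (λ x → sum λ y → ⟦ ~? x y ⟧)      ≡⟨ ∑-comm {m} {n} (λ x y → ⟦ ~? x y ⟧) ⟩
    sum (λ y → sum λ x → ⟦ ~? x y ⟧)      ≡⟨ sum-cong-≗ {n} (λ y → column y (Q? y)) ⟨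
    # Q?                                  ∎
    where
    row : ∀ x (p : Dec (P x)) → ⟦ p ⟧ ≡ # (λ y → ~? x y)
    row x (yes p) with left x p
    ... | y , r = sym (#-single (λ z → ~? x z) y r λ z r′ → functional x z y r′ r)
    row x (no ¬p) = sym (#-empty (λ y → ~? x y) λ y r → ¬p (proj₁ (sound x y r)))
    column : ∀ y (q : Dec (Q y)) → ⟦ q ⟧ ≡ # (λ x → ~? x y)
    column y (yes q) with right y q
    ... | x , r = sym (#-single (λ z → ~? z y) x r λ z r′ → injective z x y r′ r)
    column y (no ¬q) = sym (#-empty (λ x → ~? x y) λ x r → ¬q (proj₂ (sound x y r)))

  countB≡# : (p : Fin n → Bool) → countB p (allFin n) ≡ # (is? p)
  countB≡# {n} p = go id
    where
    bit : ∀ b → (if b then 1 else 0) ≡ ⟦ b Bool.≟ true ⟧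
    bit true  = refl
    bit false = refl
    go : ∀ {m} (g : Fin m → Fin n) → countB p (List.tabulate g) ≡ # (λ i → is? p (g i))
    go {zero}  g = refl
    go {suc m} g = cong₂ _+_ (bit (p (g zero))) (go (g ∘ suc))

  ∣tabulate∣ : (P? : Decidable P) → ∣ tabulate (does ∘ P?) ∣ ≡ # P?
  ∣tabulate∣ {zero}  P? = refl
  ∣tabulate∣ {suc n} P? with does (P? zero)
  ... | true  = cong suc (∣tabulate∣ (P? ∘ suc))
  ... | false = ∣tabulate∣ (P? ∘ suc)

-- The leaves of a star and the vertices of a tree `R` have to be numbered by some `Fin`. `count`
-- turns degrees computed over the numbers into counts over vertices of `G`.
record Enumeration {P : Fin n → Set} (P? : Decidable P) : Set₁ where
  field
    size      : ℕ
    element   : Fin size → Fin n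
    member    : ∀ i → P (element i)
    injective : ∀ i j → element i ≡ element j → i ≡ j
    index     : ∀ x → P x → ∃ λ i → element i ≡ x
    count     : {Q : Fin n → Set} (Q? : Decidable Q) → # (λ i → Q? (element i)) ≡ # (λ x → P? x ×-dec Q? x)

opaque
  unfolding #

  enumerate : {P : Fin n → Set} (P? : Decidable P) → Enumeration P?
  enumerate {zero} P? = record
    { size = 0 ; element = λ () ; member = λ () ; injective = λ () ; index = λ () ; count = λ _ → refl }
  enumerate {suc n} {P} P? with P? zero in eq | enumerate (P? ∘ suc)
  ... | no ¬p | e = record
    { size = E.size ; element = suc ∘ E.element ; member = E.member
    ; injective = λ i j → E.injective i j ∘ Fin.suc-injective
    ; index = index′
    ; count = λ Q? → trans (E.count (Q? ∘ suc)) (cong (λ d →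
        ⟦ d ×-dec Q? zero ⟧ + # (λ x → P? (suc x) ×-dec Q? (suc x))) (sym eq)) }
    where
    module E = Enumeration e
    index′ : ∀ x → P x → ∃ λ i → suc (E.element i) ≡ x
    index′ zero    p = ⊥-elim (¬p p)
    index′ (suc x) p with E.index x p
    ... | i , e = i , cong suc e
  ... | yes p | e = record
    { size = suc E.size ; element = element′ ; member = member′ ; injective = injective′ ; index = index′
    ; count = λ Q? → cong₂ _+_ (cong (λ d → ⟦ d ×-dec Q? zero ⟧) (sym eq)) (E.count (Q? ∘ suc)) }
    where
    module E = Enumeration e
    element′ : Fin (suc E.size) → Fin (suc n)
    element′ zero    = zero
    element′ (suc i) = suc (E.element i)
    member′ : ∀ i → P (element′ i)
    member′ zero    = p
    member′ (suc i) = E.member i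
    injective′ : ∀ i j → element′ i ≡ element′ j → i ≡ j
    injective′ zero    zero    _  = refl
    injective′ (suc i) (suc j) eq = cong suc (E.injective i j (Fin.suc-injective eq))
    index′ : ∀ x → P x → ∃ λ i → element′ i ≡ x
    index′ zero    _ = zero , refl
    index′ (suc x) p with E.index x p
    ... | i , e = suc i , cong suc e

  size≡# : {P : Fin n → Set} (P? : Decidable P) (e : Enumeration P?) → Enumeration.size e ≡ # P?
  size≡# P? e = begin
    E.size                                   ≡⟨ ones E.size ⟨
    # {E.size} {λ _ → ⊤} (λ _ → yes tt)      ≡⟨ E.count {λ _ → ⊤} (λ _ → yes tt) ⟩
    # (λ x → P? x ×-dec yes tt)              ≡⟨ #-cong (λ x → P? x ×-dec yes tt) P? (λ _ → proj₁)
        (λ _ p → p , tt) ⟩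
    # P?                                     ∎
    where
    module E = Enumeration e
    ones : ∀ m → # {m} {λ _ → ⊤} (λ _ → yes tt) ≡ m
    ones zero    = refl
    ones (suc m) = cong suc (ones m)

-- Assembling a factor from components

module Pieces (k : ℕ) (G : Graph) where

  open Neighbourhoods G using (V; Adj; adj?; Adj-sym; Adj-irrefl)

  record Piece (U : V → Set) : Set where
    field
      shape : Shape k
      emb   : SV shape → V
      edges : ∀ a b → SE shape a b → Adj (emb a) (emb b)
      inj   : ∀ a b → emb a ≡ emb b → a ≡ b
      into  : ∀ a → U (emb a)
      onto  : ∀ v → U v → ∃ λ a → emb a ≡ v

  Piece-resp : {U W : V → Set} → (∀ v → U v → W v) → (∀ v → W v → U v) → Piece U → Piece W
  Piece-resp f g p = record
    { shape = shape ; emb = emb ; edges = edges ; inj = inj ; into = λ a → f _ (into a) ; onto = λ v w →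
        onto v (g v w) }
    where open Piece p

  star-piece : (c : V) {L : V → Set} (L? : Decidable L) → (∀ v → L v → Adj c v) → 1 ≤ # L? → # L? ≤ k →
    Piece (λ v → v ≡ c ⊎ L v)
  star-piece c {L} L? adj-c 1≤ ≤k = record
    { shape = star E.size (subst (1 ≤_) (sym (size≡# L? e)) 1≤) (subst (_≤ k) (sym (size≡# L? e)) ≤k)
    ; emb = emb ; edges = λ { _ _ (ray i) → adj-c _ (E.member i) } ; inj = inj ; into = into ; onto = onto }
    where
    e : Enumeration L?
    e = enumerate L?
    module E = Enumeration e
    emb : Fin (suc E.size) → V
    emb zero    = c
    emb (suc i) = E.element i
    apart : ∀ i → c ≢ E.element i
    apart i eq = Adj-irrefl (subst (Adj c) (sym eq) (adj-c _ (E.member i)))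
    inj : ∀ a b → emb a ≡ emb b → a ≡ b
    inj zero    zero    _  = refl
    inj zero    (suc j) eq = ⊥-elim (apart j eq)
    inj (suc i) zero    eq = ⊥-elim (apart i (sym eq))
    inj (suc i) (suc j) eq = cong suc (E.injective i j eq)
    into : ∀ a → emb a ≡ c ⊎ L (emb a)
    into zero    = inj₁ refl
    into (suc i) = inj₂ (E.member i)
    onto : ∀ v → v ≡ c ⊎ L v → ∃ λ a → emb a ≡ v
    onto v (inj₁ eq) = zero , sym eq
    onto v (inj₂ l) with E.index v l
    ... | i , eq = suc i , eq

  record PartialFactor (W : V → Set) : Set where
    field
      parts    : ℕ
      shape    : Fin parts → Shape k
      emb      : ∀ i → SV (shape i) → V
      edges    : ∀ i a b → SE (shape i) a b → Adj (emb i a) (emb i b)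
      into     : ∀ i a → W (emb i a)
      cover    : ∀ v → W v → Σ (Fin parts) λ i → Σ (SV (shape i)) λ a → emb i a ≡ v
      disjoint : ∀ i a j b → emb i a ≡ emb j b → _≡_ {A = Σ (Fin parts) λ i → SV (shape i)} (i , a) (j , b)

  add-piece : {W U W′ : V → Set} → (∀ v → W′ v → W v ⊎ U v) → (∀ v → W v → W′ v) → (∀ v → U v → W′ v) →
    (∀ v → U v → ¬ W v) → PartialFactor W → Piece U → PartialFactor W′
  add-piece {W} {U} {W′} split inW inU apart F p = record
    { parts = suc F.parts ; shape = shape′ ; emb = emb′ ; edges = edges′ ; into = into′ ; cover =
        cover′ ; disjoint = disjoint′ }
    where
    module F = PartialFactor F
    module p = Piece p
    shape′ : Fin (suc F.parts) → Shape k
    shape′ zero    = p.shape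
    shape′ (suc i) = F.shape i
    emb′ : ∀ i → SV (shape′ i) → V
    emb′ zero    = p.emb
    emb′ (suc i) = F.emb i
    edges′ : ∀ i a b → SE (shape′ i) a b → Adj (emb′ i a) (emb′ i b)
    edges′ zero    = p.edges
    edges′ (suc i) = F.edges i
    into′ : ∀ i a → W′ (emb′ i a)
    into′ zero    a = inU _ (p.into a)
    into′ (suc i) a = inW _ (F.into i a)
    cover′ : ∀ v → W′ v → Σ (Fin (suc F.parts)) λ i → Σ (SV (shape′ i)) λ a → emb′ i a ≡ v
    cover′ v w with split v w
    ... | inj₁ x with F.cover v x
    ...   | i , a , e = suc i , a , e
    cover′ v w | inj₂ u with p.onto v u
    ...   | a , e = zero , a , e
    disjoint′ : ∀ i a j b → emb′ i a ≡ emb′ j b → _≡_ {A = Σ (Fin (suc F.parts)) λ i → SV (shape′ i)}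
      (i , a) (j , b)
    disjoint′ zero a zero b e = cong (zero ,_) (p.inj a b e)
    disjoint′ zero a (suc j) b e = ⊥-elim (apart _ (p.into a) (subst W (sym e) (F.into j b)))
    disjoint′ (suc i) a zero b e = ⊥-elim (apart _ (p.into b) (subst W e (F.into i a)))
    disjoint′ (suc i) a (suc j) b e = cong (λ (i , a) → suc i , a) (F.disjoint i a j b e)

  -- `X` is a union of components of `Link`, read as an undirected graph.
  Saturated : (V → V → Set) → (V → Set) → Set
  Saturated Link X = ∀ a b → Link a b → (X a → X b) × (X b → X a)

  -- U is the Link-component of x.
  record Unit (Link : V → V → Set) (x : V) : Set₁ where
    field
      U         : V → Set
      U?        : Decidable U
      here      : U x
      piece     : Piece U
      saturated : Saturated Link U
      connected : ∀ W → Saturated Link (Is W) → ∀ v → U v → Is W v → Is W x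

  -- Units are added greedily while some `x` is uncovered. The covered set `W` stays saturated; if
  -- the unit of `x` met `W`, its field `connected` would put `x` into `W`.
  assemble : {Link : V → V → Set} → (∀ x → Unit Link x) → Factor k G
  assemble {Link} unit = iterate {State} μ next (start , (λ _ _ _ → (λ ()) , λ ()) , none)
    where
    State : Set
    State = ∃ λ (W : V → Bool) → Saturated Link (Is W) × PartialFactor (Is W)
    start : V → Bool
    start _ = false
    none : PartialFactor (Is start)
    none = record { parts = 0 ; shape =
        λ () ; emb = λ () ; edges = λ () ; into = λ () ; cover = λ _ () ; disjoint = λ () }
    μ : State → ℕ
    μ (W , _) = # (λ v → ¬? (is? W v))
    next : (s : State) → Factor k G ⊎ (∃ λ s′ → μ s′ < μ s)
    next (W , sat , F) with Fin.any? (λ v → ¬? (is? W v))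
    ... | no full = inj₁ (record
      { m = F.parts ; shape = F.shape ; emb = F.emb ; edges = F.edges ; disjoint = F.disjoint
      ; cover = λ v → F.cover v (covered v (is? W v)) })
      where
      module F = PartialFactor F
      covered : ∀ v → Dec (Is W v) → Is W v
      covered v (yes w) = w
      covered v (no ¬w) = ⊥-elim (full (v , ¬w))
    ... | yes (x , ¬Wx) = inj₂ ((W′ , sat′ , add-piece out inW inU apart F piece) ,
        #-mono-< (λ v → ¬? (is? W′ v)) (λ v → ¬? (is? W v)) (λ v ¬w′ → ¬w′ ∘ inW v) x ¬Wx
            (λ ¬w′ → ¬w′ (inU x here)))
      where
      open Unit (unit x)
      W′ : V → Bool
      W′ v = does (is? W v ⊎-dec U? v)
      out : ∀ v → Is W′ v → Is W v ⊎ U v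
      out v = does⁻ (is? W v ⊎-dec U? v)
      inW : ∀ v → Is W v → Is W′ v
      inW v w = dec-true (is? W v ⊎-dec U? v) (inj₁ w)
      inU : ∀ v → U v → Is W′ v
      inU v u = dec-true (is? W v ⊎-dec U? v) (inj₂ u)
      apart : ∀ v → U v → ¬ Is W v
      apart v u w = ¬Wx (connected W sat v u w)
      sat′ : Saturated Link (Is W′)
      sat′ a b l = to , from
        where
        to : Is W′ a → Is W′ b
        to h with out a h
        ... | inj₁ w = inW b (proj₁ (sat a b l) w)
        ... | inj₂ u = inU b (proj₁ (saturated a b l) u)
        from : Is W′ b → Is W′ a
        from h with out b h
        ... | inj₁ w = inW a (proj₂ (sat a b l) w)
        ... | inj₂ u = inU a (proj₂ (saturated a b l) u)

-- Injections along edges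

module ArcCover {n : ℕ} {R : Fin n → Set} (R? : Decidable R) (π : Fin n → Fin n)
  (π-closed : ∀ v → R v → R (π v)) (π-moves : ∀ v → R v → π v ≢ v) where

  -- `W` is a set of arcs from `v` to `π v`, each represented by its tail; every vertex of `R` must
  -- occur as a tail or as a head.
  Covers : (Fin n → Bool) → Set
  Covers W = (∀ v → Is W v → R v) × (∀ v → R v → Is W v ⊎ ∃ λ w → Is W w × π w ≡ v)

  Covers? : ∀ W → Dec (Covers W)
  Covers? W = Fin.all? (λ v → is? W v →-dec R? v)
    ×-dec Fin.all? (λ v → R? v →-dec (is? W v ⊎-dec Fin.any? λ w → is? W w ×-dec (π w Fin.≟ v)))

  delete : Fin n → (Fin n → Bool) → Fin n → Bool
  delete a W x = W x ∧ not (does (x Fin.≟ a))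

  delete⁺ : ∀ a W x → Is W x → x ≢ a → Is (delete a W) x
  delete⁺ a W x w ne rewrite w | dec-false (x Fin.≟ a) ne = refl

  delete⁻ : ∀ a W x → Is (delete a W) x → Is W x × x ≢ a
  delete⁻ a W x h with W x | x Fin.≟ a
  ... | true | no ne = refl , ne

  opaque

    -- Of three consecutive arcs the middle one could be deleted: its tail is the head of the first,
    -- its head is the tail of the third, and by `π-moves` neither of these is the deleted arc. For
    -- injective `π` the arcs of a smallest cover therefore form paths with one or two arcs.
    minimal-cover : ∃ λ W → Covers W × (∀ u → Is W u → Is W (π u) → ¬ Is W (π (π u)))
    minimal-cover with minimise (search-Vec {n} search-Bool) (λ W → Covers? (lookup W))
        (λ W → # (is? (lookup W)))
          (tabulate (does ∘ R?) , (λ v h → does⁻ (R? v) (trans (sym (Vec.lookup∘tabulate (does ∘ R?) v)) h)) ,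
            λ v r → inj₁ (trans (Vec.lookup∘tabulate (does ∘ R?) v) (dec-true (R? v) r)))
    ... | F , (F⊆R , cov) , best = lookup F , (F⊆R , cov) , no-triple
      where
      no-triple : ∀ u → Is (lookup F) u → Is (lookup F) (π u) → ¬ Is (lookup F) (π (π u))
      no-triple u Fu Fπu Fππu = ℕ.<⇒≱ smaller (best W′ ((λ v h → F⊆R v (proj₁ (from v h))) , cov′))
        where
        W : Fin n → Bool
        W = delete (π u) (lookup F)
        W′ : Vec Bool n
        W′ = tabulate W
        from : ∀ v → Is (lookup W′) v → Is (lookup F) v × v ≢ π u
        from v h = delete⁻ (π u) (lookup F) v (trans (sym (Vec.lookup∘tabulate W v)) h)
        to : ∀ v → Is (lookup F) v → v ≢ π u → Is (lookup W′) v
        to v h ne = trans (Vec.lookup∘tabulate W v) (delete⁺ (π u) (lookup F) v h ne)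
        smaller : # (is? (lookup W′)) < # (is? (lookup F))
        smaller = #-mono-< (is? (lookup W′)) (is? (lookup F)) (λ v → proj₁ ∘ from v) (π u) Fπu
            (λ h → proj₂ (from (π u) h) refl)
        cov′ : ∀ v → R v → Is (lookup W′) v ⊎ ∃ λ w → Is (lookup W′) w × π w ≡ v
        cov′ v r with cov v r
        ... | inj₁ h with v Fin.≟ π u
        ...   | yes refl = inj₂ (u , to u Fu (λ e → π-moves u (F⊆R u Fu) (sym e)) , refl)
        ...   | no ne = inj₁ (to v h ne)
        cov′ v r | inj₂ (w , h , refl) with w Fin.≟ π u
        ...   | yes refl = inj₁ (to (π w) Fππu (π-moves (π u) (F⊆R (π u) Fπu)))
        ...   | no ne = inj₂ (w , to w h ne , refl)

-- Copies of K_{1,1} and K_{1,2} on the remaining vertices.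

module _ (G : Graph) where

  open Neighbourhoods G

  module PermutedPart (k : ℕ) (2≤k : 2 ≤ k) {R : V → Set} (R? : Decidable R) (π : V → V)
    (π-edge : ∀ v → R v → Adj v (π v) × R (π v)) (π-inj : ∀ v w → R v → R w → π v ≡ π w → v ≡ w)
    (F : V → Bool) (F⊆R : ∀ v → Is F v → R v) (F-covers : ∀ v → R v → Is F v ⊎ ∃ λ w → Is F w × π w ≡ v)
    (F-sparse : ∀ u → Is F u → Is F (π u) → ¬ Is F (π (π u)))
    {Link : V → V → Set}
    (link-F : ∀ v → Is F v → Link v (π v))
    (link-R : ∀ a b → Link a b → R a ⊎ R b → Is F a × b ≡ π a) where

    open Pieces k G

    private

      -- The path that begins with the arc from `s` is a star with centre `π s`. Its second leaf is
      -- present only if the arc leaving `π s` is chosen too.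
      Leaves : V → V → Set
      Leaves s v = v ≡ s ⊎ (Is F (π s) × v ≡ π (π s))

      Leaves? : ∀ s → Decidable (Leaves s)
      Leaves? s v = (v Fin.≟ s) ⊎-dec (is? F (π s) ×-dec (v Fin.≟ π (π s)))

      Start : V → Set
      Start s = Is F s × ∀ w → Is F w → π w ≢ s

      unit-from : ∀ s → Start s → ∀ x → (x ≡ π s ⊎ Leaves s x) → Unit Link x
      unit-from s (Fs , first) x x∈U = record
        { U = U ; U? = λ v → (v Fin.≟ π s) ⊎-dec Leaves? s v ; here = x∈U
        ; piece = star-piece (π s) (Leaves? s) adjacent (#-pos (Leaves? s) s (inj₁ refl))
            (ℕ.≤-trans at-most-two 2≤k)
        ; saturated = λ a b l → to a b l , from a b l
        ; connected = λ W sat v v∈U w → proj₂ (root W sat x x∈U) (proj₁ (root W sat v v∈U) w) }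
        where
        U : V → Set
        U v = v ≡ π s ⊎ Leaves s v
        Rs : R s
        Rs = F⊆R s Fs
        Rπs : R (π s)
        Rπs = proj₂ (π-edge s Rs)
        adjacent : ∀ v → Leaves s v → Adj (π s) v
        adjacent v (inj₁ refl) = Adj-sym (proj₁ (π-edge s Rs))
        adjacent v (inj₂ (_ , refl)) = proj₁ (π-edge (π s) Rπs)
        at-most-two : # (Leaves? s) ≤ 2
        at-most-two = ℕ.≤-trans
          (#-cover (λ v → v Fin.≟ s) (λ v → v Fin.≟ π (π s)) (Leaves? s)
              (λ { v (inj₁ e) → inj₁ e ; v (inj₂ (_ , e)) → inj₂ e }))
          (ℕ.≤-reflexive (cong₂ _+_ (#-single (λ v → v Fin.≟ s) s refl (λ _ → id))
              (#-single (λ v → v Fin.≟ π (π s)) _ refl (λ _ → id))))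
        U⊆R : ∀ v → U v → R v
        U⊆R v (inj₁ refl) = Rπs
        U⊆R v (inj₂ (inj₁ refl)) = Rs
        U⊆R v (inj₂ (inj₂ (_ , refl))) = proj₂ (π-edge (π s) Rπs)
        to : ∀ a b → Link a b → U a → U b
        to a b l u with link-R a b l (inj₁ (U⊆R a u))
        to a b l (inj₁ refl)                  | Fa , refl = inj₂ (inj₂ (Fa , refl))
        to a b l (inj₂ (inj₁ refl))           | Fa , refl = inj₁ refl
        to a b l (inj₂ (inj₂ (Fπs , refl)))   | Fa , refl = ⊥-elim (F-sparse s Fs Fπs Fa)
        from : ∀ a b → Link a b → U b → U a
        from a b l u with link-R a b l (inj₂ (U⊆R b u))
        from a b l (inj₁ e)                 | Fa , refl = inj₂ (inj₁ (π-inj a s (F⊆R a Fa) Rs e))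
        from a b l (inj₂ (inj₁ e))          | Fa , refl = ⊥-elim (first a Fa e)
        from a b l (inj₂ (inj₂ (Fπs , e)))  | Fa , refl = inj₁ (π-inj a (π s) (F⊆R a Fa) Rπs e)
        root : ∀ W → Saturated Link (Is W) → ∀ v → U v → (Is W v → Is W (π s)) × (Is W (π s) → Is W v)
        root W sat v (inj₁ refl) = id , id
        root W sat v (inj₂ (inj₁ refl)) = sat s (π s) (link-F s Fs)
        root W sat v (inj₂ (inj₂ (Fπs , refl))) with sat (π s) (π (π s)) (link-F (π s) Fπs)
        ... | f , g = g , f

      start? : ∀ s → Is F s → Start s ⊎ ∃ λ w → Is F w × π w ≡ s
      start? s Fs with Fin.any? (λ w → is? F w ×-dec (π w Fin.≟ s))
      ... | yes h = inj₂ h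
      ... | no h  = inj₁ (Fs , λ w Fw e → h (w , Fw , e))

      -- Following chosen arcs backwards reaches the beginning of the path after at most one step,
      -- since `F-sparse` excludes three arcs in a row.
      unit-of-arc : ∀ s → Is F s → ∀ x → x ≡ π s → Unit Link x
      unit-of-arc s Fs x e with start? s Fs
      ... | inj₁ st = unit-from s st x (inj₁ e)
      ... | inj₂ (w , Fw , refl) with start? w Fw
      ...   | inj₁ st = unit-from w st x (inj₂ (inj₂ (Fs , e)))
      ...   | inj₂ (u , Fu , refl) = ⊥-elim (F-sparse u Fu Fw Fs)

    R-unit : ∀ x → R x → Unit Link x
    R-unit x r with F-covers x r
    ... | inj₂ (w , Fw , refl) = unit-of-arc w Fw x refl
    ... | inj₁ Fx with start? x Fx
    ...   | inj₁ st = unit-from x st x (inj₂ (inj₁ refl))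
    ...   | inj₂ (w , Fw , refl) = unit-of-arc w Fw x refl

-- Stars centred at servers and at clients.

module _ (G : Graph) where

  open Neighbourhoods G

  module ServedPart (k : ℕ) (2≤k : 2 ≤ k) {I A : V → Set} (I? : Decidable I) (A? : Decidable A)
    (I∩A : ∀ {v} → I v → ¬ A v) (I→A : ∀ v u → I v → Adj v u → A u) where

    open Pieces k G
    open Clients I? using (load; load₂)
    open Splitting I? A? adj? (2 * k + 1)

    1<2k+1 : 1 < 2 * k + 1
    1<2k+1 = subst (1 <_) (ℕ.+-comm 1 (2 * k)) (s≤s (ℕ.≤-trans (ℕ.≤-trans (s≤s z≤n) 2≤k) (ℕ.m≤n*m k 2)))

    module Units {f : Assignment 2 (Graph.n G)} (min : Minimal f) {Link : V → V → Set}
      (link-I : ∀ v i → I v → Link v (f i v))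
      (link-IA : ∀ a b → Link a b → (I a ⊎ A a) ⊎ (I b ⊎ A b) → I a × ∃ λ i → f i a ≡ b) where

      open MinimalProperties {f} min I→A 1<2k+1 public

      valid : ∀ i v → I v → Adj v (f i v)
      valid = proj₁ (proj₁ min)
      upper : ∀ u → load f u ≤ 2 * k + 1
      upper = proj₁ (proj₂ (proj₁ min))
      lower : ∀ u → A u → 1 ≤ load f u
      lower = proj₂ (proj₂ (proj₁ min))

      server∈A : ∀ i v → I v → A (f i v)
      server∈A i v Iv = I→A v (f i v) Iv (valid i v Iv)

      linked : ∀ {W} → Saturated Link (Is W) → ∀ v → I v → ∀ i j → Is W (f i v) → Is W (f j v)
      linked sat v Iv i j w = proj₁ (sat v (f j v) (link-I v j Iv)) (proj₂ (sat v (f i v) (link-I v i Iv)) w)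

      -- The servers in `Y` with their clients. Only the first token is tested: `span-unit` requires
      -- that `Y` contain both servers of a client or neither.
      Span : (V → Set) → V → Set
      Span Y v = Y v ⊎ (I v × Y (f zero v))

      -- Each client is linked to its first server, so connectedness is asked of the servers only.
      span-unit : {Y : V → Set} (Y? : Decidable Y) → (∀ v → Y v → A v) →
        (∀ v → I v → ∀ i j → Y (f i v) → Y (f j v)) → ∀ u →
        (∀ W → Saturated Link (Is W) → ∀ y → Y y → (Is W y → Is W u) × (Is W u → Is W y)) →
        Piece (Span Y) → ∀ x → Span Y x → Unit Link x
      span-unit {Y} Y? Y⊆A closed u root piece x x∈U = record
        { U = Span Y ; U? = λ v → Y? v ⊎-dec (I? v ×-dec Y? (f zero v)) ; here = x∈U ; piece = piece
        ; saturated = λ a b l → to a b l , from a b l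
        ; connected = λ W sat v v∈U w → proj₂ (root′ W sat x x∈U) (proj₁ (root′ W sat v v∈U) w) }
        where
        U⊆ : ∀ v → Span Y v → I v ⊎ A v
        U⊆ v (inj₁ y) = inj₂ (Y⊆A v y)
        U⊆ v (inj₂ (i , _)) = inj₁ i
        to : ∀ a b → Link a b → Span Y a → Span Y b
        to a b l s with link-IA a b l (inj₁ (U⊆ a s))
        to a b l (inj₁ y)       | Ia , i , refl = ⊥-elim (I∩A Ia (Y⊆A a y))
        to a b l (inj₂ (_ , y)) | Ia , i , refl = inj₁ (closed a Ia zero i y)
        from : ∀ a b → Link a b → Span Y b → Span Y a
        from a b l s with link-IA a b l (inj₂ (U⊆ b s))
        from a b l (inj₁ y)        | Ia , i , refl = inj₂ (Ia , closed a Ia i zero y)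
        from a b l (inj₂ (Ib , _)) | Ia , i , refl = ⊥-elim (I∩A Ib (server∈A i a Ia))
        root′ : ∀ W → Saturated Link (Is W) → ∀ v → Span Y v → (Is W v → Is W u) × (Is W u → Is W v)
        root′ W sat v (inj₁ y) = root W sat v y
        root′ W sat v (inj₂ (Iv , y)) with root W sat (f zero v) y | sat v (f zero v) (link-I v zero Iv)
        ... | f₁ , g₁ | f₂ , g₂ = f₁ ∘ f₂ , g₂ ∘ g₁

      -- Every client of `u` leaves both tokens there, so the load is twice the number of clients,
      -- and a load between 1 and 2k + 1 means between 1 and k leaves.
      star-unit : ∀ u → A u → (∀ v → I v → ∀ i → f i v ≡ u → f (opposite i) v ≡ u) → ∀ x → Span (_≡ u) x →
        Unit Link x
      star-unit u Au solid = span-unit (Fin._≟ u) (λ { _ refl → Au }) closed u (λ { W sat y refl → id , id })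
          (star-piece u L? (λ { v (Iv , refl) → Adj-sym (valid zero v Iv) })
              (half-≥ (# L?) (subst (1 ≤_) double (lower u Au)))
                  (half-≤ (# L?) (subst (_≤ 2 * k + 1) double (upper u))))
        where
        L? : Decidable (λ v → I v × f zero v ≡ u)
        L? v = I? v ×-dec (f zero v Fin.≟ u)
        closed : ∀ v → I v → ∀ i j → f i v ≡ u → f j v ≡ u
        closed v Iv i j e with this-or-opposite i j
        ... | inj₁ refl = e
        ... | inj₂ refl = solid v Iv i e
        double : load f u ≡ # L? + # L?
        double = trans (load₂ f u) (cong (# L? +_) (#-cong (λ v → I? v ×-dec (f (suc zero) v Fin.≟ u)) L?
          (λ v (Iv , e) → Iv , solid v Iv (suc zero) e) (λ v (Iv , e) → Iv , solid v Iv zero e)))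
        half-≥ : ∀ l → 1 ≤ l + l → 1 ≤ l
        half-≥ (suc l) _ = s≤s z≤n
        half-≤ : ∀ l → l + l ≤ 2 * k + 1 → l ≤ k
        half-≤ l h with l ℕ.≤? k
        ... | yes l≤k = l≤k
        ... | no ¬l = ⊥-elim (ℕ.1+n≰n
            (ℕ.≤-trans (ℕ.≤-trans (ℕ.≤-reflexive (lem k)) (ℕ.+-mono-≤ (ℕ.≰⇒> ¬l) (ℕ.≰⇒> ¬l))) h))
          where
          lem : ∀ k → suc (2 * k + 1) ≡ suc k + suc k
          lem = solve-∀

      sole-client : ∀ u → load f u ≡ 1 → ∀ v w i j → I v → I w → f i v ≡ u → f j w ≡ u → v ≡ w
      sole-client u one v w i j Iv Iw p q = go (v Fin.≟ w) i j p q
        where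
        P₀? : Decidable (λ v → I v × f zero v ≡ u)
        P₀? v = I? v ×-dec (f zero v Fin.≟ u)
        P₁? : Decidable (λ v → I v × f (suc zero) v ≡ u)
        P₁? v = I? v ×-dec (f (suc zero) v Fin.≟ u)
        total : # P₀? + # P₁? ≡ 1
        total = trans (sym (load₂ f u)) one
        two : {T : V → Set} (T? : Decidable T) → v ≢ w → T v → T w → 2 ≤ # T?
        two T? v≢w tv tw = ℕ.≤-trans
            (ℕ.≤-reflexive (sym (cong₂ _+_ (#-single (λ x → x Fin.≟ v) v refl (λ _ → id))
                (#-single (λ x → x Fin.≟ w) w refl (λ _ → id)))))
          (#-disjoint (λ x → x Fin.≟ v) (λ x → x Fin.≟ w) T? (λ { _ refl → tv }) (λ { _ refl → tw })
              (λ { _ refl → v≢w }))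
        absurd : 2 ≤ # P₀? + # P₁? → v ≡ w
        absurd h = ⊥-elim (ℕ.1+n≰n (subst (2 ≤_) total h))
        go : Dec (v ≡ w) → ∀ i j → f i v ≡ u → f j w ≡ u → v ≡ w
        go (yes e) _ _ _ _ = e
        go (no ne) zero zero p q = absurd (ℕ.≤-trans (two P₀? ne (Iv , p) (Iw , q)) (ℕ.m≤m+n _ _))
        go (no ne) zero (suc zero) p q = absurd (ℕ.+-mono-≤ (#-pos P₀? v (Iv , p)) (#-pos P₁? w (Iw , q)))
        go (no ne) (suc zero) zero p q = absurd (ℕ.+-mono-≤ (#-pos P₀? w (Iw , q)) (#-pos P₁? v (Iv , p)))
        go (no ne) (suc zero) (suc zero) p q = absurd (ℕ.≤-trans (two P₁? ne (Iv , p) (Iw , q)) (ℕ.m≤n+m _ _))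

      -- The client is the centre and its servers are the leaves, at most two and hence allowed by
      -- `2≤k`. Load 1 makes `v` the only client of these servers, so no other client is attached to
      -- the unit.
      cherry-unit : ∀ v → I v → (∀ i → load f (f i v) ≡ 1) →
        ∀ x → Span (λ y → ∃ λ i → f i v ≡ y) x → Unit Link x
      cherry-unit v Iv ones = span-unit Y? (λ { _ (i , refl) → server∈A i v Iv }) closed (f zero v) root
          (Piece-resp to from (star-piece v Y? (λ { _ (i , refl) → valid i v Iv })
              (#-pos Y? (f zero v) (zero , refl)) (ℕ.≤-trans at-most-two 2≤k)))
        where
        Y : V → Set
        Y y = ∃ λ i → f i v ≡ y
        Y? : Decidable Y
        Y? y = Fin.any? λ i → f i v Fin.≟ y
        only : ∀ w → I w → ∀ i → Y (f i w) → w ≡ v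
        only w Iw i (j , e) = sole-client (f j v) (ones j) w v i j Iw Iv (sym e) refl
        closed : ∀ w → I w → ∀ i j → Y (f i w) → Y (f j w)
        closed w Iw i j y with only w Iw i y
        ... | refl = j , refl
        root : ∀ W → Saturated Link (Is W) → ∀ y → Y y →
          (Is W y → Is W (f zero v)) × (Is W (f zero v) → Is W y)
        root W sat _ (i , refl) = linked sat v Iv i zero , linked sat v Iv zero i
        to : ∀ w → w ≡ v ⊎ Y w → Span Y w
        to w (inj₁ refl) = inj₂ (Iv , zero , refl)
        to w (inj₂ y) = inj₁ y
        from : ∀ w → Span Y w → w ≡ v ⊎ Y w
        from w (inj₁ y) = inj₂ y
        from w (inj₂ (Iw , y)) = inj₁ (only w Iw zero y)
        at-most-two : # Y? ≤ 2
        at-most-two = ℕ.≤-trans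
          (#-cover (λ y → y Fin.≟ f zero v) (λ y → y Fin.≟ f (suc zero) v) Y?
              (λ { y (zero , e) → inj₁ (sym e) ; y (suc zero , e) → inj₂ (sym e) }))
          (ℕ.≤-reflexive (cong₂ _+_ (#-single (λ y → y Fin.≟ f zero v) _ refl (λ _ → id))
              (#-single (λ y → y Fin.≟ f (suc zero) v) _ refl (λ _ → id))))

-- Booleans, walks and cycles.

∧⁺ : ∀ {a b} → a ≡ true → b ≡ true → a ∧ b ≡ true
∧⁺ refl e = e

false≢true : ∀ {b} → b ≡ false → b ≢ true
false≢true refl ()

if-zero : ∀ b {a : ℕ} → a ≡ 0 → (if b then a else 0) ≡ 0
if-zero true  e = e
if-zero false e = refl

≢1⇒≡ᵇ : ∀ d → d ≢ 1 → (d ≡ᵇ 1) ≡ false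
≢1⇒≡ᵇ 0 _ = refl
≢1⇒≡ᵇ 1 h = ⊥-elim (h refl)
≢1⇒≡ᵇ (suc (suc d)) _ = refl

Walk-++ : ∀ {R : Graph} {x y z} → Walk R x y → Walk R y z → Walk R x z
Walk-++ [] w = w
Walk-++ (e ∷ v) w = e ∷ Walk-++ v w

Walk-reverse : ∀ {R : Graph} {x y} → Walk R x y → Walk R y x
Walk-reverse [] = []
Walk-reverse {R} (e ∷ w) = Walk-++ (Walk-reverse w) (trans (Graph.sym R _ _) e ∷ [])

sub-irrelevant : ∀ {k} {R : Graph} {x y p a ix iy p′ a′ ix′ iy′} →
  _≡_ {A = TRV k R} (sub x y p a ix iy) (sub x y p′ a′ ix′ iy′)
sub-irrelevant {p = p} {a} {ix} {iy} {p′} {a′} {ix′} {iy′}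
  rewrite Bool.T-irrelevant p p′ | Bool.T-irrelevant a a′ | Bool.T-irrelevant ix ix′ | Bool.T-irrelevant
      iy iy′ = refl

module CycleNeighbours {A : Set} (_~_ : A → A → Set) where

  Passed : A → Set
  Passed b = ∃ λ a → ∃ λ c → a ≢ c × a ~ b × b ~ c

  inner : ∀ a b l z → All (z ≢_) (a ∷ b ∷ l) → Unique (a ∷ b ∷ l) → Linked _~_ (a ∷ b ∷ l ++ z ∷ []) →
    All Passed (b ∷ l)
  inner a b [] z (z≢a ∷ _) _ (r ∷ s ∷ _) = (a , z , z≢a ∘ sym , r , s) ∷ []
  inner a b (c ∷ l) z (_ ∷ z∉) ((_ ∷ a≢c ∷ _) ∷ u) (r ∷ s ∷ rs) =
    (a , c , a≢c , r , s) ∷ inner b c l z z∉ u (s ∷ rs)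

  -- This keeps the leaves of a tree candidate off its cycles: a leaf does not have two different
  -- neighbours.
  around : ∀ x xs → 2 ≤ length xs → Unique (x ∷ xs) → Linked _~_ (x ∷ xs ++ x ∷ []) → All Passed (x ∷ xs)
  around x (y ∷ []) (s≤s ()) _ _
  around x (y ∷ z ∷ zs) _ unique@((x≢y ∷ x≢z ∷ x∉) ∷ unique′@(y∉ ∷ _)) linked@(r ∷ s ∷ rs)
    with Linked-snoc⁻ x (y ∷ z ∷ zs) x linked
  ... | _ , back = (last z zs , y , (λ e → last-All z zs y∉ (sym e)) , back , r)
        ∷ (x , z , x≢z , r , s) ∷ inner y z zs x (x≢y ∷ x≢z ∷ x∉) unique′ (s ∷ rs)

-- Components of full servers as members of the family T(2k+1).

module _ (G : Graph) where

  open Neighbourhoods G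

  module FullComponent (k : ℕ) (2≤k : 2 ≤ k) {I A : V → Set} (I? : Decidable I) (A? : Decidable A)
    (I∩A : ∀ {v} → I v → ¬ A v) (I→A : ∀ v u → I v → Adj v u → A u) where

    open Pieces k G
    open Clients I? using (load; load₂)
    open Splitting I? A? adj? (2 * k + 1)
    open ServedPart G k 2≤k I? A? I∩A I→A using (1<2k+1)

    module _ {f : Assignment 2 (Graph.n G)} (min : Minimal f) (Y : V → Bool) (Y⊆A : ∀ y → Is Y y → A y)
      (full : ∀ y → Is Y y → load f y ≡ 2 * k + 1) (closed : ∀ x y → Is Y x → H f x y → Is Y y)
      (root : V) (root∈Y : Is Y root) (reach : ∀ y → Is Y y → Star (H f) root y) where

      open MinimalProperties {f} min I→A 1<2k+1

      private

        valid : ∀ i v → I v → Adj v (f i v)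
        valid = proj₁ (proj₁ min)

        H-sym : ∀ {x y} → H f x y → H f y x
        H-sym (v , j) = v , Joins-sym {f} j

        H⊆A : ∀ {x y} → H f x y → A x
        H⊆A (v , Iv , _ , i , refl , _) = I→A v (f i v) Iv (valid i v Iv)

        Solid : V → V → Set
        Solid x v = I v × f zero v ≡ x × f (suc zero) v ≡ x

        Solid? : ∀ x v → Dec (Solid x v)
        Solid? x v = I? v ×-dec (f zero v Fin.≟ x) ×-dec (f (suc zero) v Fin.≟ x)

        Solid⊆A : ∀ {x v} → Solid x v → A x
        Solid⊆A {v = v} (Iv , refl , _) = I→A v (f zero v) Iv (valid zero v Iv)

        -- The solid clients of the component, with the server recovered as `f zero v`. They become
        -- the leaves of the tree `R`.
        Leaf : V → Set
        Leaf v = Solid (f zero v) v × Is Y (f zero v)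

        Leaf? : Decidable Leaf
        Leaf? v = Solid? (f zero v) v ×-dec is? Y (f zero v)

        K : V → Set
        K v = Is Y v ⊎ Leaf v

        opaque

          K? : Decidable K
          K? v = is? Y v ⊎-dec Leaf? v

        Edge : V → V → Set
        Edge x y = H f x y ⊎ (Solid x y ⊎ Solid y x)

        opaque

          Edge? : ∀ x y → Dec (Edge x y)
          Edge? x y = H? f x y ⊎-dec (Solid? x y ⊎-dec Solid? y x)

        Edge-sym : ∀ {x y} → Edge x y → Edge y x
        Edge-sym (inj₁ h) = inj₁ (H-sym h)
        Edge-sym (inj₂ (inj₁ s)) = inj₂ (inj₂ s)
        Edge-sym (inj₂ (inj₂ s)) = inj₂ (inj₁ s)

        Edge-irrefl : ∀ {x} → ¬ Edge x x
        Edge-irrefl (inj₁ (_ , _ , ne , _)) = ne refl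
        Edge-irrefl (inj₂ (inj₁ s)) = I∩A (proj₁ s) (Solid⊆A s)
        Edge-irrefl (inj₂ (inj₂ s)) = I∩A (proj₁ s) (Solid⊆A s)

        Edge-Y : ∀ {x y} → Is Y x → Is Y y → Edge x y → H f x y
        Edge-Y yx yy (inj₁ h) = h
        Edge-Y {y = y} yx yy (inj₂ (inj₁ s)) = ⊥-elim (I∩A (proj₁ s) (Y⊆A y yy))
        Edge-Y {x} yx yy (inj₂ (inj₂ s)) = ⊥-elim (I∩A (proj₁ s) (Y⊆A x yx))

        Edge-Leaf : ∀ {v y} → Leaf v → Edge v y → y ≡ f zero v
        Edge-Leaf ((Iv , _) , _) (inj₁ h) = ⊥-elim (I∩A Iv (H⊆A h))
        Edge-Leaf ((Iv , _) , _) (inj₂ (inj₁ s)) = ⊥-elim (I∩A Iv (Solid⊆A s))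
        Edge-Leaf _ (inj₂ (inj₂ (_ , e , _))) = sym e

        en : Enumeration K?
        en = enumerate K?

        module E = Enumeration en

        -- All pendant vertices of T_R are already leaves of R, so step (d) of the construction adds nothing.
        R : Graph
        R = record
          { n = E.size
          ; adj = λ i j → does (Edge? (E.element i) (E.element j))
          ; sym = λ i j → does-⇔ (mk⇔ Edge-sym Edge-sym) (Edge? (E.element i) (E.element j))
              (Edge? (E.element j) (E.element i))
          ; irrefl = λ i → dec-false (Edge? (E.element i) (E.element i)) Edge-irrefl }

        edge⁻ : ∀ i j → adj R i j ≡ true → Edge (E.element i) (E.element j)
        edge⁻ i j = does⁻ (Edge? (E.element i) (E.element j))

        edge⁺ : ∀ i j → Edge (E.element i) (E.element j) → adj R i j ≡ true
        edge⁺ i j = dec-true (Edge? (E.element i) (E.element j))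

        σ h : V → ℕ
        σ x = # (Solid? x)
        h x = # (H? f x)

        -- A solid client contributes two tokens and a split client one. The split clients at `x`
        -- correspond to its neighbours in `H`, as by `no-parallel` no neighbour is reached through
        -- two clients.
        load-formula : ∀ x → 2 * σ x + h x ≡ load f x
        load-formula x = sym (begin
          load f x                                          ≡⟨ load₂ f x ⟩
          # P₀? + # P₁?                                     ≡⟨ cong₂ _+_ part₀ part₁ ⟩
          (σ x + # Q₀?) + (σ x + # Q₁?)                     ≡⟨ arith (σ x) (# Q₀?) (# Q₁?) ⟩
          2 * σ x + (# Q₀? + # Q₁?)                         ≡⟨ cong (2 * σ x +_) split-part ⟨
          2 * σ x + # J?                                    ≡⟨ cong (2 * σ x +_) matched ⟩
          2 * σ x + h x                                     ∎)
          where
          arith : ∀ s a b → (s + a) + (s + b) ≡ 2 * s + (a + b)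
          arith = solve-∀
          P₀? : Decidable (λ v → I v × f zero v ≡ x)
          P₀? v = I? v ×-dec (f zero v Fin.≟ x)
          P₁? : Decidable (λ v → I v × f (suc zero) v ≡ x)
          P₁? v = I? v ×-dec (f (suc zero) v Fin.≟ x)
          Q₀ Q₁ J : V → Set
          Q₀ v = I v × f zero v ≡ x × f (suc zero) v ≢ x
          Q₁ v = I v × f (suc zero) v ≡ x × f zero v ≢ x
          J v = ∃ λ y → Joins f v x y
          Q₀? : Decidable Q₀
          Q₀? v = I? v ×-dec (f zero v Fin.≟ x) ×-dec ¬? (f (suc zero) v Fin.≟ x)
          Q₁? : Decidable Q₁
          Q₁? v = I? v ×-dec (f (suc zero) v Fin.≟ x) ×-dec ¬? (f zero v Fin.≟ x)
          J? : Decidable J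
          J? v = Fin.any? λ y → Joins? f v x y
          part₀ : # P₀? ≡ σ x + # Q₀?
          part₀ = #-partition P₀? (Solid? x) Q₀? (λ v (Iv , e) → dec v Iv e (f (suc zero) v Fin.≟ x))
            (λ { v (Iv , e , _) → Iv , e }) (λ { v (Iv , e , _) → Iv , e })
                (λ { v (_ , _ , e) (_ , _ , ne) → ne e })
            where
            dec : ∀ v → I v → f zero v ≡ x → Dec (f (suc zero) v ≡ x) → Solid x v ⊎ Q₀ v
            dec v Iv e (yes e′) = inj₁ (Iv , e , e′)
            dec v Iv e (no ne)  = inj₂ (Iv , e , ne)
          part₁ : # P₁? ≡ σ x + # Q₁?
          part₁ = #-partition P₁? (Solid? x) Q₁? (λ v (Iv , e) → dec v Iv e (f zero v Fin.≟ x))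
            (λ { v (Iv , _ , e) → Iv , e }) (λ { v (Iv , e , _) → Iv , e })
                (λ { v (_ , e , _) (_ , _ , ne) → ne e })
            where
            dec : ∀ v → I v → f (suc zero) v ≡ x → Dec (f zero v ≡ x) → Solid x v ⊎ Q₁ v
            dec v Iv e (yes e′) = inj₁ (Iv , e′ , e)
            dec v Iv e (no ne)  = inj₂ (Iv , e , ne)
          split-part : # J? ≡ # Q₀? + # Q₁?
          split-part = #-partition J? Q₀? Q₁?
            (λ { v (y , Iv , ne , zero , p , q) → inj₁ (Iv , p , λ e → ne (trans (sym e) q))
               ; v (y , Iv , ne , suc zero , p , q) → inj₂ (Iv , p , λ e → ne (trans (sym e) q)) })
            (λ { v (Iv , e , ne) → f (suc zero) v , Iv , ne ∘ sym , zero , e , refl })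
            (λ { v (Iv , e , ne) → f zero v , Iv , ne ∘ sym , suc zero , e , refl })
            (λ { v (_ , e , _) (_ , _ , ne) → ne e })
          matched : # J? ≡ h x
          matched = #-matching J? (H? f x) (λ v y → Joins? f v x y) (λ v y j → (y , j) , (v , j))
              (λ _ j → j) (λ _ j → j)
            functional (λ v w y jv jw → no-parallel v w x y jv jw)
            where
            functional : ∀ v y z → Joins f v x y → Joins f v x z → y ≡ z
            functional v y z (_ , x≢y , i , p , q) (_ , _ , j , p′ , q′) with this-or-opposite i j
            ... | inj₁ refl = trans (sym q) q′
            ... | inj₂ refl = ⊥-elim (x≢y (trans (sym p′) q))

        formula : ∀ x → Is Y x → 2 * σ x + h x ≡ 2 * k + 1
        formula x y = trans (load-formula x) (full x y)

        deg-count : ∀ i → deg R i ≡ # (λ x → K? x ×-dec Edge? (E.element i) x)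
        deg-count i = begin
          deg R i                                     ≡⟨ countB≡# (adj R i) ⟩
          # (is? (adj R i))                           ≡⟨ #-cong (is? (adj R i))
              (λ j → Edge? (E.element i) (E.element j)) (edge⁻ i) (edge⁺ i) ⟩
          # (λ j → Edge? (E.element i) (E.element j)) ≡⟨ E.count (Edge? (E.element i)) ⟩
          # (λ x → K? x ×-dec Edge? (E.element i) x)  ∎

        Solid-K : ∀ {x v} → Is Y x → Solid x v → Leaf v
        Solid-K y (Iv , refl , e) = (Iv , refl , e) , y

        deg-Y : ∀ i → Is Y (E.element i) → deg R i ≡ h (E.element i) + σ (E.element i)
        deg-Y i yi = trans (deg-count i) (#-partition (λ x → K? x ×-dec Edge? (E.element i) x)
            (H? f (E.element i)) (Solid? (E.element i))
          (λ { x (_ , inj₁ e) → inj₁ e ; x (_ , inj₂ (inj₁ s)) → inj₂ s ; x (_ , inj₂ (inj₂ s)) →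
              ⊥-elim (I∩A (proj₁ s) (Y⊆A _ yi)) })
          (λ x e → inj₁ (closed _ x yi e) , inj₁ e) (λ x s → inj₂ (Solid-K yi s) , inj₂ (inj₁ s))
          (λ x e s → I∩A (proj₁ s) (H⊆A (H-sym e))))

        deg-Leaf : ∀ i → Leaf (E.element i) → deg R i ≡ 1
        deg-Leaf i l = trans (deg-count i) (#-single (λ x → K? x ×-dec Edge? (E.element i) x)
            (f zero (E.element i))
          (inj₁ (proj₂ l) , inj₂ (inj₂ (proj₁ l))) (λ { x (_ , e) → Edge-Leaf l e }))

        leaf-Leaf : ∀ i → Leaf (E.element i) → isLeaf R i ≡ true
        leaf-Leaf i l = cong (_≡ᵇ 1) (deg-Leaf i l)

        -- The degree is σ + h, and its double is at least 2σ + h = 2k + 1 > 2; so a server never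
        -- has degree 1.
        leaf-Y : ∀ i → Is Y (E.element i) → isLeaf R i ≡ false
        leaf-Y i y = ≢1⇒≡ᵇ (deg R i) λ e → small (σ (E.element i)) (h (E.element i))
            (trans (sym (deg-Y i y)) e) (formula _ y)
          where
          small : ∀ s t → t + s ≡ 1 → 2 * s + t ≢ 2 * k + 1
          small s t e eq = ℕ.<⇒≱ (subst (2 <_) (ℕ.+-comm 1 (2 * k)) (s≤s (ℕ.≤-trans 2≤k (ℕ.m≤n*m k 2))))
            (ℕ.≤-trans (ℕ.≤-reflexive (sym eq)) (ℕ.≤-trans (ℕ.m≤m+n (2 * s + t) t)
                (ℕ.≤-reflexive (trans (lem s t) (cong (2 *_) e)))))
            where
            lem : ∀ s t → 2 * s + t + t ≡ 2 * (t + s)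
            lem = solve-∀

        not-leaf : ∀ i → isLeaf R i ≡ false → Is Y (E.element i)
        not-leaf i e = [ id , (λ l → ⊥-elim (false≢true e (leaf-Leaf i l))) ]′ (E.member i)

        is-leaf : ∀ i → isLeaf R i ≡ true → Leaf (E.element i)
        is-leaf i e = [ (λ y → ⊥-elim (false≢true (leaf-Y i y) e)) , id ]′ (E.member i)

        member-A : ∀ i → A (E.element i) → Is Y (E.element i)
        member-A i a = [ id , (λ l → ⊥-elim (I∩A (proj₁ (proj₁ l)) a)) ]′ (E.member i)

        internal-Y : ∀ i → internal R i ≡ true → Is Y (E.element i)
        internal-Y i e = not-leaf i (flip (isLeaf R i) e)
          where
          flip : ∀ b → not b ≡ true → b ≡ false
          flip false _ = refl

        dI-Y : ∀ i → Is Y (E.element i) → dI R i ≡ h (E.element i)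
        dI-Y i yi = begin
          dI R i                                        ≡⟨ countB≡# (λ j → adj R i j ∧ internal R j) ⟩
          # (is? (λ j → adj R i j ∧ internal R j))      ≡⟨ #-cong (is? (λ j → adj R i j ∧ internal R j))
              (λ j → H? f (E.element i) (E.element j)) to from ⟩
          # (λ j → H? f (E.element i) (E.element j))    ≡⟨ E.count (H? f (E.element i)) ⟩
          # (λ x → K? x ×-dec H? f (E.element i) x)     ≡⟨ #-cong (λ x → K? x ×-dec H? f (E.element i) x)
              (H? f (E.element i)) (λ _ → proj₂) (λ x e → inj₁ (closed _ x yi e) , e) ⟩
          h (E.element i)                               ∎
          where
          to : ∀ j → adj R i j ∧ internal R j ≡ true → H f (E.element i) (E.element j)
          to j e = Edge-Y yi (internal-Y j (Bool.∧-conicalʳ (adj R i j) _ e))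
              (edge⁻ i j (Bool.∧-conicalˡ (adj R i j) _ e))
          from : ∀ j → H f (E.element i) (E.element j) → adj R i j ∧ internal R j ≡ true
          from j e = ∧⁺ (edge⁺ i j (inj₁ e)) (cong not (leaf-Y j (closed _ _ yi e)))

        nLeaves-Y : ∀ i → Is Y (E.element i) → nLeaves R i ≡ σ (E.element i)
        nLeaves-Y i yi = begin
          nLeaves R i                                   ≡⟨ countB≡# (λ j → adj R i j ∧ isLeaf R j) ⟩
          # (is? (λ j → adj R i j ∧ isLeaf R j))        ≡⟨ #-cong (is? (λ j → adj R i j ∧ isLeaf R j))
              (λ j → Solid? (E.element i) (E.element j)) to from ⟩
          # (λ j → Solid? (E.element i) (E.element j))  ≡⟨ E.count (Solid? (E.element i)) ⟩
          # (λ x → K? x ×-dec Solid? (E.element i) x)   ≡⟨ #-cong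
              (λ x → K? x ×-dec Solid? (E.element i) x) (Solid? (E.element i)) (λ _ → proj₂)
                  (λ x s → inj₂ (Solid-K yi s) , s) ⟩
          σ (E.element i)                               ∎
          where
          to : ∀ j → adj R i j ∧ isLeaf R j ≡ true → Solid (E.element i) (E.element j)
          to j e = solid (is-leaf j (Bool.∧-conicalʳ (adj R i j) _ e))
              (edge⁻ i j (Bool.∧-conicalˡ (adj R i j) _ e))
            where
            solid : Leaf (E.element j) → Edge (E.element i) (E.element j) → Solid (E.element i) (E.element j)
            solid l (inj₁ e′) = ⊥-elim (I∩A (proj₁ (proj₁ l)) (H⊆A (H-sym e′)))
            solid l (inj₂ (inj₁ s)) = s
            solid l (inj₂ (inj₂ s)) = ⊥-elim (I∩A (proj₁ s) (Y⊆A _ yi))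
          from : ∀ j → Solid (E.element i) (E.element j) → adj R i j ∧ isLeaf R j ≡ true
          from j s = ∧⁺ (edge⁺ i j (inj₂ (inj₁ s))) (leaf-Leaf j (Solid-K yi s))

        σ≤k : ∀ x → Is Y x → σ x ≤ k
        σ≤k x y = bound (σ x) (h x) (formula x y)
          where
          bound : ∀ s t → 2 * s + t ≡ 2 * k + 1 → s ≤ k
          bound s t e with s ℕ.≤? k
          ... | yes l = l
          ... | no ¬l = ⊥-elim (ℕ.1+n≰n (ℕ.≤-trans (ℕ.≤-reflexive (lem k))
              (ℕ.≤-trans (ℕ.*-monoʳ-≤ 2 (ℕ.≰⇒> ¬l)) (ℕ.≤-trans (ℕ.m≤m+n _ _) (ℕ.≤-reflexive e)))))
            where
            lem : ∀ k → suc (2 * k + 1) ≡ 2 * suc k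
            lem = solve-∀

        h-odd : ∀ x → Is Y x → h x ≡ 2 * (k ∸ σ x) + 1
        h-odd x y = solve (σ x) (h x) (k ∸ σ x) k (ℕ.m+[n∸m]≡n (σ≤k x y)) (formula x y)
          where
          solve : ∀ s t r c → s + r ≡ c → 2 * s + t ≡ 2 * c + 1 → t ≡ 2 * r + 1
          solve s t r _ refl e = ℕ.+-cancelˡ-≡ (2 * s) _ _ (trans e (lem s r))
            where
            lem : ∀ s r → 2 * (s + r) + 1 ≡ 2 * s + (2 * r + 1)
            lem = solve-∀

        admissible : Admissible k R
        -- The full load 2σ + h = 2k + 1 gives (a) in the form h = 2(k - σ) + 1, and (b) with
        -- equality.
        admissible i notleaf = (k ∸ σ x , ℕ.m∸n≤m k (σ x) , trans (dI-Y i y) (h-odd x y)) ,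
            ℕ.≤-reflexive (trans (cong₂ (λ a b → 2 * a + b) (nLeaves-Y i y) (dI-Y i y)) (formula x y))
          where
          x : V
          x = E.element i
          y : Is Y x
          y = not-leaf i notleaf

        -- In step (d), r = k - σ and σ leaves are adjacent, so k - r - σ = 0.
        no-extra : ∀ i → Is Y (E.element i) → extra k R i ≡ 0
        no-extra i y = if-zero (dI R i <ᵇ (2 * k + 1)) (begin
          k ∸ ⌊ dI R i ∸ 1 /2⌋ ∸ nLeaves R i           ≡⟨ cong₂ (λ a b → k ∸ ⌊ a ∸ 1 /2⌋ ∸ b)
              (trans (dI-Y i y) (h-odd x y)) (nLeaves-Y i y) ⟩
          k ∸ ⌊ 2 * (k ∸ σ x) + 1 ∸ 1 /2⌋ ∸ σ x        ≡⟨ cong (λ a → k ∸ ⌊ a /2⌋ ∸ σ x)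
              (trans (ℕ.m+n∸n≡m _ 1) (cong ((k ∸ σ x) +_) (ℕ.+-identityʳ _))) ⟩
          k ∸ ⌊ (k ∸ σ x) + (k ∸ σ x) /2⌋ ∸ σ x        ≡⟨ cong (λ a → k ∸ a ∸ σ x) (ℕ.n≡⌊n+n/2⌋ (k ∸ σ x)) ⟨
          k ∸ (k ∸ σ x) ∸ σ x                          ≡⟨ cong (_∸ σ x) (ℕ.m∸[m∸n]≡n (σ≤k x y)) ⟩
          σ x ∸ σ x                                    ≡⟨ ℕ.n∸n≡0 (σ x) ⟩
          0                                            ∎)
          where
          x : V
          x = E.element i

        r : Fin E.size
        r = proj₁ (E.index root (inj₁ root∈Y))

        r≡ : E.element r ≡ root
        r≡ = proj₂ (E.index root (inj₁ root∈Y))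

        walk-Y : ∀ {x y} → Is Y x → Star (H f) x y → ∀ i j → E.element i ≡ x → E.element j ≡ y → Walk R i j
        walk-Y yx ε i j refl e = subst (Walk R i) (E.injective i j (sym e)) []
        walk-Y yx (_◅_ {j = z} step steps) i j refl e with E.index z (inj₁ (closed _ z yx step))
        ... | l , refl = edge⁺ i l (inj₁ step) ∷ walk-Y (closed _ z yx step) steps l j refl e

        walk-from-root : ∀ i → Walk R r i
        walk-from-root i with E.member i
        ... | inj₁ y = walk-Y root∈Y (reach _ y) r i r≡ refl
        ... | inj₂ l with E.index (f zero (E.element i)) (inj₁ (proj₂ l))
        ...   | j , e = Walk-++ (walk-Y root∈Y (reach _ (proj₂ l)) r j r≡ e)
                  (edge⁺ j i (inj₂ (inj₁ (subst (λ z → Solid z (E.element i)) (sym e) (proj₁ l)))) ∷ [])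

        -- By `around` a cycle of `R` passes through servers only, because the sole neighbour of a
        -- leaf is its server. Edges between servers come from `H`, which has no cycle.
        acyclic : ¬ HasCycle R
        acyclic (x , xs , 2≤len , unique , linked) = H-acyclic (E.element x) (List.map E.element xs)
            (subst (2 ≤_) (sym (List.length-map E.element xs)) 2≤len)
            (Unique.map⁺ (λ {i} {j} → E.injective i j) unique)
            (subst (λ l → Linked (H f) (E.element x ∷ l)) (List.map-++ E.element xs (x ∷ []))
              (Linked.map⁺ (Linked-map-All (λ i j yi yj e → Edge-Y yi yj (edge⁻ i j e)) in-Y linked)))
          where
          open CycleNeighbours (λ i j → adj R i j ≡ true)
          passed-Y : ∀ {i} → Passed i → Is Y (E.element i)
          passed-Y {i} (a , b , a≢b , p , q) with E.member i
          ... | inj₁ y = y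
          ... | inj₂ l = ⊥-elim
              (a≢b (E.injective a b (trans (Edge-Leaf l (Edge-sym (edge⁻ a i p)))
                  (sym (Edge-Leaf l (edge⁻ i b q))))))
          in-Y : All (λ i → Is Y (E.element i)) (x ∷ xs ++ x ∷ [])
          in-Y with All.map passed-Y (around x xs 2≤len unique linked)
          ... | y ∷ ys = y ∷ All.++⁺ ys (y ∷ [])

        is-tree : IsTree R
        is-tree = size-pos r , (λ i j → Walk-++ (Walk-reverse (walk-from-root i)) (walk-from-root j)) ,
            acyclic
          where
          size-pos : ∀ {m} → Fin m → 1 ≤ m
          size-pos {suc m} _ = s≤s z≤n

        -- The client in this witness is placed at the vertex subdividing the edge `xy` of R -
        -- Leaf(R).
        middle : ∀ x y → T (adj R x y) → T (internal R x) → T (internal R y) → H f (E.element x) (E.element y)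
        middle x y a ix iy = Edge-Y (internal-Y x (Equivalence.to Bool.T-≡ ix))
            (internal-Y y (Equivalence.to Bool.T-≡ iy)) (edge⁻ x y (Equivalence.to Bool.T-≡ a))

        none-new : ∀ {X : Set} x → T (internal R x) → ∀ i → T (i <ᵇ extra k R x) → X
        none-new x ix i p = ⊥-elim (subst (λ e → T (i <ᵇ e))
            (no-extra x (internal-Y x (Equivalence.to Bool.T-≡ ix))) p)

        emb : TRV k R → V
        emb (orig i) = E.element i
        emb (sub x y _ a ix iy) = proj₁ (middle x y a ix iy)
        emb (new x ix i p) = none-new x ix i p

        Joins-adj : ∀ {v x y} → Joins f v x y → Adj x v
        Joins-adj {v} (Iv , _ , i , refl , _) = Adj-sym (valid i v Iv)

        emb-edges : ∀ a b → TRE k R a b → Adj (emb a) (emb b)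
        emb-edges _ _ (oo x y e leafy) = leaf-edge (edge⁻ x y e)
          where
          leaf-edge : Edge (E.element x) (E.element y) → Adj (E.element x) (E.element y)
          leaf-edge (inj₂ (inj₁ (Iy , p , _))) = subst (λ z → Adj z (E.element y)) p
              (Adj-sym (valid zero (E.element y) Iy))
          leaf-edge (inj₂ (inj₂ (Ix , p , _))) = subst (Adj (E.element x)) p (valid zero (E.element x) Ix)
          leaf-edge (inj₁ hxy) = ⊥-elim (false≢true
            (cong₂ _∨_ (leaf-Y x (member-A x (H⊆A hxy))) (leaf-Y y (member-A y (H⊆A (H-sym hxy))))) leafy)
        emb-edges _ _ (os₁ x y p a ix iy) = Joins-adj (proj₂ (middle x y a ix iy))
        emb-edges _ _ (os₂ x y p a ix iy) = Joins-adj (Joins-sym {f} (proj₂ (middle x y a ix iy)))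
        emb-edges _ _ (on x ix i p) = none-new x ix i p

        element-not-split : ∀ i {v x y} → Joins f v x y → E.element i ≢ v
        element-not-split i j refl with E.member i
        ... | inj₁ y = I∩A (proj₁ j) (Y⊆A _ y)
        ... | inj₂ ((_ , _ , e) , _) = Joins-split {f} j (sym e)

        same-ends : ∀ {v x y x′ y′} → Joins f v x y → Joins f v x′ y′ → (x ≡ x′ × y ≡ y′) ⊎ (x ≡ y′ × y ≡ x′)
        same-ends (_ , _ , i , refl , refl) (_ , _ , j , p , q) with this-or-opposite i j
        ... | inj₁ refl = inj₁ (p , q)
        ... | inj₂ refl = inj₂ (trans (cong (λ l → f l _) (sym (opposite-involutive i))) q , p)

        -- A client determines its two servers up to order, and the convention x < y for subdivision
        -- vertices rules out the swapped order.
        sub-injective : ∀ x y p a ix iy x′ y′ p′ a′ ix′ iy′ →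
          proj₁ (middle x y a ix iy) ≡ proj₁ (middle x′ y′ a′ ix′ iy′) →
          _≡_ {A = TRV k R} (sub x y p a ix iy) (sub x′ y′ p′ a′ ix′ iy′)
        sub-injective x y p a ix iy x′ y′ p′ a′ ix′ iy′ e
          with same-ends (subst (λ v → Joins f v _ _) e (proj₂ (middle x y a ix iy)))
              (proj₂ (middle x′ y′ a′ ix′ iy′))
        ... | inj₂ (e₁ , e₂) with E.injective x y′ e₁ | E.injective y x′ e₂
        ...   | refl | refl = ⊥-elim (ℕ.<-asym (ℕ.<ᵇ⇒< (toℕ x) (toℕ y) p) (ℕ.<ᵇ⇒< (toℕ y) (toℕ x) p′))
        sub-injective x y p a ix iy x′ y′ p′ a′ ix′ iy′ e | inj₁ (e₁ , e₂) with E.injective x x′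
            e₁ | E.injective y y′ e₂
        ...   | refl | refl = sub-irrelevant

        emb-inj : ∀ a b → emb a ≡ emb b → a ≡ b
        emb-inj (orig i) (orig j) e = cong orig (E.injective i j e)
        emb-inj (orig i) (sub x y p a ix iy) e = ⊥-elim (element-not-split i (proj₂ (middle x y a ix iy)) e)
        emb-inj (sub x y p a ix iy) (orig i) e = ⊥-elim
            (element-not-split i (proj₂ (middle x y a ix iy)) (sym e))
        emb-inj (sub x y p a ix iy) (sub x′ y′ p′ a′ ix′ iy′) e =
            sub-injective x y p a ix iy x′ y′ p′ a′ ix′ iy′ e
        emb-inj (new x ix i p) _ _ = none-new x ix i p
        emb-inj _ (new x ix i p) _ = none-new x ix i p

        U : V → Set
        U v = Is Y v ⊎ (I v × Is Y (f zero v))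

        ends-Y : ∀ {v x y} → Joins f v x y → Is Y x → ∀ i → Is Y (f i v)
        ends-Y {v} {x} {y} j yx i with Joins-server {f} j i
        ... | inj₁ e = subst (Is Y) (sym e) yx
        ... | inj₂ e = subst (Is Y) (sym e) (closed x y yx (v , j))

        emb-into : ∀ a → U (emb a)
        emb-into (orig i) with E.member i
        ... | inj₁ y = inj₁ y
        ... | inj₂ ((Iv , _) , y) = inj₂ (Iv , y)
        emb-into (sub x y p a ix iy) =
            inj₂ (proj₁ joins , ends-Y joins (internal-Y x (Equivalence.to Bool.T-≡ ix)) zero)
          where
          joins : Joins f (emb (sub x y p a ix iy)) (E.element x) (E.element y)
          joins = proj₂ (middle x y a ix iy)
        emb-into (new x ix i p) = none-new x ix i p

        emb-onto-sub : ∀ v x y → Joins f v (E.element x) (E.element y) → Is Y (E.element x) →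
          toℕ x < toℕ y → ∃ λ a → emb a ≡ v
        -- `middle` supplies some client joining the two servers; `no-parallel` identifies it with
        -- `v`.
        emb-onto-sub v x y j yx l = sub x y (ℕ.<⇒<ᵇ l) a ix iy , no-parallel _ v _ _
            (proj₂ (middle x y a ix iy)) j
          where
          a : T (adj R x y)
          a = Equivalence.from Bool.T-≡ (edge⁺ x y (inj₁ (v , j)))
          ix : T (internal R x)
          ix = Equivalence.from Bool.T-≡ (cong not (leaf-Y x yx))
          iy : T (internal R y)
          iy = Equivalence.from Bool.T-≡ (cong not (leaf-Y y (closed _ _ yx (v , j))))

        emb-onto : ∀ v → U v → ∃ λ a → emb a ≡ v
        emb-onto v (inj₁ y) with E.index v (inj₁ y)
        ... | i , e = orig i , e
        emb-onto v (inj₂ (Iv , y)) = go (f zero v Fin.≟ f (suc zero) v)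
          where
          go : Dec (f zero v ≡ f (suc zero) v) → ∃ λ a → emb a ≡ v
          go (yes e) with E.index v (inj₂ ((Iv , refl , sym e) , y))
          ... | i , e′ = orig i , e′
          go (no ne) with E.index (f zero v) (inj₁ y) | E.index (f (suc zero) v)
              (inj₁ (closed _ _ y (v , Iv , ne , zero , refl , refl)))
          ... | i , p | j , q = order (toℕ i ℕ.<? toℕ j) (toℕ j ℕ.<? toℕ i)
            where
            joins : Joins f v (E.element i) (E.element j)
            joins = subst₂ (Joins f v) (sym p) (sym q) (Iv , ne , zero , refl , refl)
            yi : Is Y (E.element i)
            yi = subst (Is Y) (sym p) y
            order : Dec (toℕ i < toℕ j) → Dec (toℕ j < toℕ i) → ∃ λ a → emb a ≡ v
            order (yes l) _ = emb-onto-sub v i j joins yi l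
            order (no _) (yes l) = emb-onto-sub v j i (Joins-sym {f} joins) (closed _ _ yi (v , joins)) l
            order (no ¬l) (no ¬l′) =
                ⊥-elim (proj₁ (proj₂ joins) (cong E.element
                    (Fin.toℕ-injective (ℕ.≤-antisym (ℕ.≮⇒≥ ¬l′) (ℕ.≮⇒≥ ¬l)))))

      full-piece : Piece U
      full-piece = record
        { shape = tree R is-tree admissible ; emb = emb ; edges = emb-edges ; inj = emb-inj ; into =
            emb-into ; onto = emb-onto }

-- Case distinction on the load of a server.

module _ (G : Graph) where

  open Neighbourhoods G

  module ServedUnits (k : ℕ) (2≤k : 2 ≤ k) {I A : V → Set} (I? : Decidable I) (A? : Decidable A)
    (I∩A : ∀ {v} → I v → ¬ A v) (I→A : ∀ v u → I v → Adj v u → A u) where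

    open Pieces k G
    open Clients I? using (load)
    open Splitting I? A? adj? (2 * k + 1)
    open ServedPart G k 2≤k I? A? I∩A I→A

    module _ {f : Assignment 2 (Graph.n G)} (min : Minimal f) {Link : V → V → Set}
      (link-I : ∀ v i → I v → Link v (f i v))
      (link-IA : ∀ a b → Link a b → (I a ⊎ A a) ⊎ (I b ⊎ A b) → I a × ∃ λ i → f i a ≡ b) where

      open Units {f} min link-I link-IA

      full-step : ∀ {x y} → H f x y → A x × load f x ≡ 2 * k + 1 → A y × load f y ≡ 2 * k + 1
      full-step {x} {y} (v , j@(Iv , _ , i , _ , q)) (_ , fx) with split-loads v x y j
      ... | inj₁ (_ , fy)  = subst A q (server∈A (opposite i) v Iv) , fy
      ... | inj₂ (one , _) = ⊥-elim (ℕ.<⇒≢ 1<2k+1 (trans (sym one) fx))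

      full-path : ∀ {x y} → Star (H f) x y → A x × load f x ≡ 2 * k + 1 → A y × load f y ≡ 2 * k + 1
      full-path ε p = p
      full-path (s ◅ ss) p = full-path ss (full-step s p)

      linked-path : ∀ W → Saturated Link (Is W) → ∀ {x y} → Star (H f) x y →
        (Is W y → Is W x) × (Is W x → Is W y)
      linked-path W sat ε = id , id
      linked-path W sat ((v , Iv , _ , i , refl , refl) ◅ ss) with linked-path W sat ss
      ... | back , forth = linked sat v Iv (opposite i) i ∘ back , forth ∘ linked sat v Iv i (opposite i)

      full-unit : ∀ u → A u → load f u ≡ 2 * k + 1 → ∀ x → Span (_≡ u) x → Unit Link x
      -- The invariant stores a path from `u` to each server of `Y`. It yields the full load on `Y`,
      -- the connectedness of the tree and that of the unit.
      full-unit u Au fu x x∈ with closure (H? f) (λ Y → ∀ y → Is Y y → Star (H f) u y)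
          (λ Y y z reach Yy _ h w Yw → [ (λ { refl → reach y Yy ◅◅ (h ◅ ε) }) , reach w ]′ (insert⁻ z Y w Yw))
          (λ y → does (y Fin.≟ u)) (λ y e → subst (Star (H f) u) (sym (does⁻ (y Fin.≟ u) e)) ε)
      ... | Y , reach , start , closed = span-unit (is? Y) Y⊆A closed′ u
          (λ W sat y Yy → linked-path W sat (reach y Yy))
            (FullComponent.full-piece G k 2≤k I? A? I∩A I→A {f} min Y Y⊆A
                (λ y Yy → proj₂ (full-path (reach y Yy) (Au , fu))) closed u u∈Y reach)
            x (inSpan x∈)
        where
        u∈Y : Is Y u
        u∈Y = start u (dec-true (u Fin.≟ u) refl)
        Y⊆A : ∀ y → Is Y y → A y
        Y⊆A y Yy = proj₁ (full-path (reach y Yy) (Au , fu))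
        closed′ : ∀ v → I v → ∀ i j → Is Y (f i v) → Is Y (f j v)
        closed′ v Iv i j y with f i v Fin.≟ f j v | this-or-opposite i j
        ... | yes e | _ = subst (Is Y) e y
        ... | no _  | inj₁ refl = y
        ... | no ne | inj₂ refl = closed (f i v) (f j v) y (v , Iv , ne , i , refl , refl)
        inSpan : Span (_≡ u) x → Span (Is Y) x
        inSpan (inj₁ refl) = inj₁ u∈Y
        inSpan (inj₂ (Ix , e)) = inj₂ (Ix , subst (Is Y) (sym e) u∈Y)

      -- If `u` is not full, a split client at `u` has two servers of load 1 by `split-loads` and
      -- gives a cherry; otherwise all clients of `u` are solid and form a star.
      served-unit : ∀ u → A u → ∀ x → Span (_≡ u) x → Unit Link x
      served-unit u Au x x∈ = go (load f u ℕ.≟ 2 * k + 1)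
          (Fin.any? λ v → I? v ×-dec Fin.any? λ i → (f i v Fin.≟ u) ×-dec ¬? (f (opposite i) v Fin.≟ u))
        where
        go : Dec (load f u ≡ 2 * k + 1) → Dec (∃ λ v → I v × ∃ λ i → f i v ≡ u × f (opposite i) v ≢ u) →
          Unit Link x
        go (yes fu) _ = full-unit u Au fu x x∈
        go (no ¬fu) (yes (v , Iv , i , p , ne)) = cherry-unit v Iv ones x (inSpan x∈)
          where
          one : load f u ≡ 1 × load f (f (opposite i) v) ≡ 1
          one = [ ⊥-elim ∘ ¬fu ∘ proj₁ , id ]′ (split-loads v u (f (opposite i) v)
              (Iv , ne ∘ sym , i , p , refl))
          ones : ∀ j → load f (f j v) ≡ 1
          ones j with this-or-opposite i j
          ... | inj₁ refl = trans (cong (load f) p) (proj₁ one)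
          ... | inj₂ refl = proj₂ one
          inSpan : Span (_≡ u) x → Span (λ y → ∃ λ j → f j v ≡ y) x
          inSpan (inj₁ e) = inj₁ (i , trans p (sym e))
          inSpan (inj₂ (Ix , e)) = inj₂ (Ix , i , trans p (sym e))
        go (no _) (no solid) = star-unit u Au
          (λ v Iv i p → [ id , (λ ne → ⊥-elim (solid (v , Iv , i , p , ne))) ]′
              (dec (f (opposite i) v Fin.≟ u))) x x∈
          where
          dec : ∀ {y} → Dec (y ≡ u) → y ≡ u ⊎ y ≢ u
          dec (yes e) = inj₁ e
          dec (no ne) = inj₂ ne

  -- Gluing the served part and the rest.

  factor : ∀ k → 2 ≤ k →
    ({X : V → Set} (X? : Decidable X) → Independent′ X → 2 * # X? ≤ (2 * k + 1) * # (N? X?)) →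
    (∀ v → ∃ (Adj v)) → Factor k G
  factor k 2≤k wide neighbour with extremal-independent-set
  ... | I , I? , indep , ext = build I-assignment R-injection
    where
    open Distribution G k wide neighbour I? indep ext
    open Splitting I? A? adj? (2 * k + 1)
    open Pieces k G
    I→A : ∀ v u → I v → Adj v u → A u
    I→A v u Iv e = v , Iv , e
    build : ∃ Feasible → (∃ λ (π : V → V) → (∀ v → R v → Adj v (π v) × R (π v)) ×
      (∀ v w → R v → R w → π v ≡ π w → v ≡ w)) → Factor k G
    build feasible (π , π-edge , π-inj) = glue (minimal feasible) minimal-cover
      where
      open ArcCover R? π (λ v r → proj₂ (π-edge v r)) (λ v r e →
          Adj-irrefl (subst (Adj v) e (proj₁ (π-edge v r))))
      glue : ∃ Minimal → (∃ λ F → Covers F × (∀ u → Is F u → Is F (π u) → ¬ Is F (π (π u)))) → Factor k G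
      glue (f , min) (F , (F⊆R , F-covers) , F-sparse) = assemble unit
        where
        -- The arcs from clients to their servers together with the chosen arcs on `R`. The
        -- components of this relation are the vertex sets of the components of the factor.
        Link : V → V → Set
        Link a b = (I a × ∃ λ i → f i a ≡ b) ⊎ (Is F a × b ≡ π a)
        link-R : ∀ a b → Link a b → R a ⊎ R b → Is F a × b ≡ π a
        link-R a b (inj₂ l) _ = l
        link-R a b (inj₁ (Ia , _)) (inj₁ r) = ⊥-elim (proj₁ r Ia)
        link-R a b (inj₁ (Ia , i , refl)) (inj₂ r) = ⊥-elim (proj₂ r (a , Ia , proj₁ (proj₁ min) i a Ia))
        R-outside : ∀ {v} → R v → ¬ (I v ⊎ A v)
        R-outside (¬i , ¬a) = [ ¬i , ¬a ]′
        link-IA : ∀ a b → Link a b → (I a ⊎ A a) ⊎ (I b ⊎ A b) → I a × ∃ λ i → f i a ≡ b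
        link-IA a b (inj₁ l) _ = l
        link-IA a b (inj₂ (Fa , refl)) (inj₁ h) = ⊥-elim (R-outside (F⊆R a Fa) h)
        link-IA a b (inj₂ (Fa , refl)) (inj₂ h) = ⊥-elim (R-outside (proj₂ (π-edge a (F⊆R a Fa))) h)
        open PermutedPart G k 2≤k R? π π-edge π-inj F F⊆R F-covers F-sparse {Link}
            (λ v Fv → inj₂ (Fv , refl)) link-R
        served : ∀ u → A u → ∀ x → x ≡ u ⊎ (I x × f zero x ≡ u) → Unit Link x
        served = ServedUnits.served-unit k 2≤k I? A? I∩A I→A {f} min {Link}
            (λ v i Iv → inj₁ (Iv , i , refl)) link-IA
        unit : ∀ x → Unit Link x
        unit x = go (I? x) (A? x)
          where
          go : Dec (I x) → Dec (A x) → Unit Link x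
          go (yes Ix) _ = served (f zero x) (x , Ix , proj₁ (proj₁ min) zero x Ix) x (inj₂ (Ix , refl))
          go (no _) (yes Ax) = served x Ax x (inj₁ refl)
          go (no ¬Ix) (no ¬Ax) = R-unit x (¬Ix , ¬Ax)

-- Use of the degree condition.

theorem1p5 : (k : ℕ) → 2 ≤ k → (G : Graph) → (d a : ℕ) →
    IsMinDegree G d → IsIndependenceNumber G a →
    2 * a ≤ (2 * k + 1) * d → Factor k G
theorem1p5 k 2≤k G d a ((v₀ , _) , d≤deg) (_ , ≤a) bound = factor G k 2≤k wide neighbour
  where
  open Neighbourhoods G
  small : {X : V → Set} (X? : Decidable X) → Independent′ X → # X? ≤ a
  small {X} X? indep = subst (_≤ a) (∣tabulate∣ X?) (≤a (tabulate (does ∘ X?))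
      λ u v u∈ v∈ → Bool.¬-not (indep u v (from u u∈) (from v v∈)))
    where
    from : ∀ u → u ∈ tabulate (does ∘ X?) → X u
    from u u∈ = does⁻ (X? u) (trans (sym (Vec.lookup∘tabulate (does ∘ X?) u)) (Vec.[]=⇒lookup u∈))
  1≤a : 1 ≤ a
  1≤a = subst (_≤ a) (#-single (λ v → v Fin.≟ v₀) v₀ refl (λ _ → id))
      (small (λ v → v Fin.≟ v₀) λ { _ _ refl refl → Adj-irrefl })
  -- A single vertex is independent, so `a` is at least 1, and minimum degree 0 would make the right
  -- side vanish. Hence no vertex is isolated.
  positive : ∀ e → 2 * a ≤ (2 * k + 1) * e → 1 ≤ e
  positive zero    b = ⊥-elim
      (ℕ.1+n≰n (ℕ.≤-trans (ℕ.≤-trans 1≤a (ℕ.m≤n*m a 2)) (subst (2 * a ≤_) (ℕ.*-zeroʳ (2 * k + 1)) b)))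
  positive (suc _) _ = s≤s z≤n
  d≤# : ∀ v → d ≤ # (adj? v)
  d≤# v = subst (d ≤_) (countB≡# (adj G v)) (d≤deg v)
  neighbour : ∀ v → ∃ (Adj v)
  neighbour v = #-witness (adj? v) (ℕ.≤-trans (positive d bound) (d≤# v))
  wide : {X : V → Set} (X? : Decidable X) → Independent′ X → 2 * # X? ≤ (2 * k + 1) * # (N? X?)
  wide {X} X? indep = go (Fin.any? X?)
    where
    go : Dec (∃ X) → 2 * # X? ≤ (2 * k + 1) * # (N? X?)
    go (no none) = subst (λ t → 2 * t ≤ (2 * k + 1) * # (N? X?)) (sym (#-empty X? λ x Xx → none (x , Xx))) z≤n
    -- Any one `v` in `X` already has enough neighbours: 2|X| ≤ 2a ≤ (2k + 1)d ≤ (2k + 1)|N(X)|.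
    go (yes (v , Xv)) = ℕ.≤-trans (ℕ.*-monoʳ-≤ 2 (small X? indep)) (ℕ.≤-trans bound
      (ℕ.*-monoʳ-≤ (2 * k + 1) (ℕ.≤-trans (d≤# v) (#-mono (adj? v) (N? X?) λ u e → v , Xv , e))))
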